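{- Let $n=2^s\geq 4$ and let $(a_0,a_1,\ldots,a_{n-1})\in\mathbb{F}_2^n$. There exists a normal element of $\mathbb{F}_{2^n}$ over $\mathbb{F}_2$ whose corresponding vector is $(a_0,a_1,\ldots,a_{n-1})$ if and only if all of the following hold: 1) $a_0=1$ and $a_{n/2}=0$; 2) $a_i=a_{n-i}$ for all $1\leq i\leq n/2-1$; 3) $\sum_{1\leq i\leq n/2-1,\ i\text{ odd}} a_i=1$ in $\mathbb{F}_2$.
   Context: An element $\alpha\in\mathbb{F}_{2^n}$ is a normal element of $\mathbb{F}_{2^n}$ over $\mathbb{F}_2$ if $\{\alpha,\alpha^2,\alpha^{2^2},\ldots,\alpha^{2^{n-1}}\}$ is a basis of $\mathbb{F}_{2^n}$ over $\mathbb{F}_2$. The trace function is $\mathrm{Tr}_{2^n|2}(x)=\sum_{i=0}^{n-1}x^{2^i}$. The corresponding vector of $\alpha\in\mathbb{F}_{2^n}$ is $(a_0,\ldots,a_{n-1})\in\mathbb{F}_2^n$ with $a_i=\mathrm{Tr}_{2^n|2}(\alpha\cdot\alpha^{2^i})$ for $0\leq i\leq n-1$. -}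

module Defs where

open import Level using (Level; _⊔_)
open import Algebra.Bundles using (CommutativeRing)
open import Algebra.Apartness.Bundles using (HeytingField; HeytingCommutativeRing)
import Algebra.Properties.Semiring.Exp as SemiringExp
import Algebra.Properties.Semiring.Sum as SemiringSum
open import Data.Bool.Base using (if_then_else_)
open import Data.Bool.Properties using (xor-∧-commutativeRing)
open import Data.Fin.Base using (Fin; toℕ)
open import Data.Nat.Base as ℕ using (ℕ; suc; NonZero; _≡ᵇ_)
open import Data.Nat.DivMod using (_/_; _%_; _mod_)
open import Data.Product.Base using (∃; _×_)
open import Data.Vec.Functional using (Vector)
open import Function.Bundles using (Inverse)
open import Relation.Binary.PropositionalEquality using (_≡_; setoid)

private variable
  c ℓ₁ ℓ₂ : Level

-- 𝔽₂ is Bool with xor as addition and ∧ as multiplication.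
module F₂ where
  open CommutativeRing xor-∧-commutativeRing public using (Carrier; 0#; 1#; semiring)
  open SemiringSum semiring public using (sum-syntax)

commutativeRing : HeytingField c ℓ₁ ℓ₂ → CommutativeRing c ℓ₁
commutativeRing F = HeytingCommutativeRing.commutativeRing (HeytingField.heytingCommutativeRing F)

-- A Heyting field that is in bijection with some Fin q has decidable equality,
-- so its apartness is ≉ and it is a field in the classical sense. As finite
-- fields of equal order are isomorphic, 𝔽_q is any field F with HasOrder F q.
HasOrder : HeytingField c ℓ₁ ℓ₂ → ℕ → Set (c ⊔ ℓ₁)
HasOrder F q = Inverse (CommutativeRing.setoid (commutativeRing F)) (setoid (Fin q))

module Extension (F : HeytingField c ℓ₁ ℓ₂) where
  open CommutativeRing (commutativeRing F)
  open SemiringExp semiring using (_^_)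
  open SemiringSum semiring using (sum-syntax)

  -- The map 𝔽₂ → F through which 𝔽₂ is regarded as the prime subfield of F
  -- and acts on F by scalars; it is a ring homomorphism when F has order 2ⁿ.
  ι : F₂.Carrier → Carrier
  ι b = if b then 1# else 0#

  combination : ∀ {n} → Vector F₂.Carrier n → Vector Carrier n → Carrier
  combination {n} k v = ∑[ i < n ] (ι (k i) * v i)

  LinearlyIndependent : ∀ {n} → Vector Carrier n → Set ℓ₁
  LinearlyIndependent v = ∀ k → combination k v ≈ 0# → ∀ i → k i ≡ F₂.0#

  Spanning : ∀ {n} → Vector Carrier n → Set (c ⊔ ℓ₁)
  Spanning v = ∀ x → ∃ λ k → x ≈ combination k v

  IsBasis : ∀ {n} → Vector Carrier n → Set (c ⊔ ℓ₁)
  IsBasis v = LinearlyIndependent v × Spanning v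

  conjugates : ∀ n → Carrier → Vector Carrier n
  conjugates n α i = α ^ (2 ℕ.^ toℕ i)

  IsNormal : ℕ → Carrier → Set (c ⊔ ℓ₁)
  IsNormal n α = IsBasis (conjugates n α)

  Tr : ℕ → Carrier → Carrier
  Tr n x = ∑[ i < n ] (x ^ (2 ℕ.^ toℕ i))

  -- The trace takes values in F, so the equation aᵢ = Tr(α · α^(2^i)) of
  -- elements of 𝔽₂ is stated in F, through ι.
  IsCorrespondingVector : ∀ {n} → Carrier → Vector F₂.Carrier n → Set ℓ₁
  IsCorrespondingVector {n} α a = ∀ i → ι (a i) ≈ Tr n (α * α ^ (2 ℕ.^ toℕ i))

-- The sum of aᵢ over the odd i with 1 ≤ i ≤ n/2 − 1, where i = j + 1. As i < n,
-- i mod n is just i as an element of Fin n.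
oddSum : ∀ n .{{_ : NonZero n}} → Vector F₂.Carrier n → F₂.Carrier
oddSum n a = F₂.sum-syntax (n / 2 ℕ.∸ 1) λ j →
  let i = suc (toℕ j) in if i % 2 ≡ᵇ 1 then a (i mod n) else F₂.0#

{-# OPTIONS --safe #-}

-- Let φ be the Frobenius map, n = 2ˢ and h = n/2. As 1 + φ is nilpotent of order n
-- with kernel {0, 1} and (1 + φ)ⁿ⁻¹ = Tr, an element is normal iff its trace is 1.
-- The corresponding vector of α is symmetric with a₀ = Tr α and a_h = 0, and its sum
-- over odd indices below h is θ · θ² = 1, where θ is the trace of α to 𝔽₄.
-- Conversely 𝔽₂[x]/(xⁿ − 1) acts on F through φ and on vectors by cyclic shifts;
-- replacing α by c α multiplies its vector by the norm c c*. With z = x + x⁻¹, the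
-- symmetric vectors with a_h = 0 form a free cyclic module over 𝔽₂[z]/(zʰ), in
-- which two vectors satisfying the three conditions differ by a multiple of z².
-- As c = 1 + (1 + x) zᵏ⁻¹ has norm 1 + zᵏ + z²ᵏ⁻¹, successive multiplications
-- raise the order of the difference from 2 to h, where it vanishes.
module Submission where

open import Defs
open import Algebra.Apartness.Bundles using (HeytingField)
import Algebra.Apartness.Properties.HeytingCommutativeRing as HeytingProperties
open import Algebra.Bundles using (CommutativeMonoid; CommutativeRing)
import Algebra.Properties.CommutativeMonoid.Sum as CMSum
import Algebra.Properties.CommutativeSemiring.Exp as Exp
import Algebra.Properties.Group as GroupProperties
import Algebra.Properties.Semiring.Mult as Mult
import Algebra.Properties.Semiring.Sum as SemiringSum
import Algebra.Solver.Ring as RingSolver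
open import Algebra.Solver.Ring.AlmostCommutativeRing
open import Data.Bool.Base using (Bool; true; false; _xor_; _∧_; if_then_else_)
import Data.Bool.Properties as Bool
open import Data.Bool.Solver using (module xor-∧-Solver)
open import Data.Fin.Base as Fin using (Fin; zero; suc; toℕ)
open import Data.Fin.Permutation using (Permutation; permutation)
import Data.Fin.Properties as Fin
open import Data.Maybe.Base using (Maybe; just; nothing)
open import Data.Nat.Base as ℕ using (ℕ; zero; suc; NonZero)
open import Data.Nat.DivMod as ℕ using (_/_; _%_; _mod_; m≡m%n+[m/n]*n)
import Data.Nat.Properties as ℕ
open import Data.Nat.Tactic.RingSolver using (solve-∀)
open import Data.Product.Base using (∃; _×_; _,_; proj₁; proj₂)
open import Data.Sum.Base using (_⊎_; inj₁; inj₂; [_,_]′)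
open import Data.Vec.Functional using (Vector)
open import Function.Base using (_∘_; case_of_)
open import Function.Bundles using (Inverse; _⇔_; mk⇔)
open import Function.Definitions using (Injective)
import Function.Endo.Propositional as Endo
open import Level using (_⊔_)
open import Relation.Binary.Definitions using (tri<; tri≈; tri>)
open import Relation.Binary.PropositionalEquality as ≡ using (_≡_; _≢_; _≗_)
open import Relation.Nullary using (¬_; Dec; yes; no; contradiction)
open import Relation.Nullary.Decidable using (map′; decidable-stable; isYes)

-- The norm of c comes from one coincidence: in characteristic 2, (1 + x) + (1 + x⁻¹) and (1 + x)(1
-- + x⁻¹) are both z. For k ≥ 2 the term z²ᵏ⁻¹ has higher order than zᵏ, so exactly the coefficient
-- of zᵏ can be flipped. For k = 1 the two terms cancel and c = x has norm 1, so this construction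
-- cannot change the coefficient of z; the third condition settles that coefficient in advance. In
-- the cyclic module the value at 0 is the constant coefficient, and once it vanishes, the odd sum
-- is the coefficient of z. Hence the start at order 2. The end at order h uses that h is a power of
-- 2: zʰ = xʰ + x⁻ʰ = 0, because 2h = n. Neither the quotient rings nor a dimension theory is built.
-- Ring elements appear only as operators on F and on sequences over ℕ, with m = n - 1 in the role
-- of -1. Existence of an element of trace 1, and independence of a spanning family of conjugates,
-- come from comparing F with sets of bit vectors.

module BinarySequences where

  open import Data.Bool.Properties using (xor-same; xor-identityʳ)
  open import Data.Nat.Base
  open import Data.Nat.DivMod
  open import Data.Nat.Properties
  open import Relation.Binary.PropositionalEquality
  open xor-∧-Solver using (solve; _:+_; _:=_)

  -- The residues add up to a multiple of n that is less than 2n. This turns negation modulo n into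
  -- a statement about representatives.
  complementary-residues : ∀ n .{{_ : NonZero n}} i j k → i + j ≡ k * n →
    (i % n ≡ 0 × j % n ≡ 0) ⊎ i % n + j % n ≡ n
  complementary-residues n i j k i+j≡kn with i % n + j % n <? n
  ... | yes r<n = inj₁ (m+n≡0⇒m≡0 _ r≡0 , m+n≡0⇒n≡0 (i % n) r≡0)
    where
    r≡0 : i % n + j % n ≡ 0
    r≡0 = begin
      i % n + j % n        ≡⟨ m<n⇒m%n≡m r<n ⟨
      (i % n + j % n) % n  ≡⟨ %-distribˡ-+ i j n ⟨
      (i + j) % n          ≡⟨ cong (_% n) i+j≡kn ⟩
      (k * n) % n          ≡⟨ m*n%n≡0 k n ⟩
      0                    ∎
      where open ≡-Reasoning
  ... | no r≮n = inj₂ (begin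
      r                ≡⟨ m∸n+n≡m n≤r ⟨
      r ∸ n + n        ≡⟨ cong (_+ n) (m<n⇒m%n≡m (m<n+o⇒m∸n<o r n r<2n)) ⟨
      (r ∸ n) % n + n  ≡⟨ cong (_+ n) (m≤n⇒[n∸m]%m≡n%m n≤r) ⟩
      r % n + n        ≡⟨ cong (_+ n) (%-distribˡ-+ i j n) ⟨
      (i + j) % n + n  ≡⟨ cong (λ t → t % n + n) i+j≡kn ⟩
      (k * n) % n + n  ≡⟨ cong (_+ n) (m*n%n≡0 k n) ⟩
      n                ∎)
    where
    open ≡-Reasoning
    r = i % n + j % n
    n≤r : n ≤ r
    n≤r = ≮⇒≥ r≮n
    r<2n : r < n + n
    r<2n = +-mono-< (m%n<n i n) (m%n<n j n)

  ∣-∣-complementary : ∀ a b c → a + b ≡ c + c → ∣ a - c ∣ ≡ ∣ b - c ∣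
  ∣-∣-complementary a b c a+b≡2c = begin
    ∣ a - c ∣          ≡⟨ ∣m+n-m+o∣≡∣n-o∣ c a c ⟨
    ∣ c + a - c + c ∣  ≡⟨ cong₂ ∣_-_∣ (+-comm c a) (sym a+b≡2c) ⟩
    ∣ a + c - a + b ∣  ≡⟨ ∣m+n-m+o∣≡∣n-o∣ a c b ⟩
    ∣ c - b ∣          ≡⟨ ∣-∣-comm c b ⟩
    ∣ b - c ∣          ∎
    where open ≡-Reasoning

  -- Binary sequences under sums of two shifts

  Sequence : Set
  Sequence = ℕ → Bool

  infixl 6 _⊕_
  _⊕_ : Sequence → Sequence → Sequence
  (v ⊕ w) i = v i xor w i

  -- The action of xᵖ + x^q, where x is the shift by one.
  shifts : ℕ → ℕ → Sequence → Sequence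
  shifts p q v i = v (p + i) xor v (q + i)

  shifts-cong : ∀ p q {v w} → v ≗ w → shifts p q v ≗ shifts p q w
  shifts-cong p q v≗w i = cong₂ _xor_ (v≗w (p + i)) (v≗w (q + i))

  shifts-⊕ : ∀ p q v w → shifts p q (v ⊕ w) ≗ shifts p q v ⊕ shifts p q w
  shifts-⊕ p q v w i = solve 4 (λ a b c d → (a :+ b) :+ (c :+ d) := (a :+ c) :+ (b :+ d)) refl
    (v (p + i)) (w (p + i)) (v (q + i)) (w (q + i))

  shifts-square : ∀ p q v → shifts p q (shifts p q v) ≗ shifts (p + p) (q + q) v
  shifts-square p q v i = begin
    (v (p + (p + i)) xor v (q + (p + i))) xor (v (p + (q + i)) xor v (q + (q + i)))
      ≡⟨ cong (λ j → (v (p + (p + i)) xor v (q + (p + i))) xor (v j xor v (q + (q + i)))) (exchange p q i) ⟩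
    (v (p + (p + i)) xor v (q + (p + i))) xor (v (q + (p + i)) xor v (q + (q + i)))
      ≡⟨ solve 3 (λ a b c → (a :+ b) :+ (b :+ c) := a :+ c) refl (v (p + (p + i))) (v (q + (p + i))) (v (q + (q + i))) ⟩
    v (p + (p + i)) xor v (q + (q + i))
      ≡⟨ cong₂ (λ j k → v j xor v k) (+-assoc p p i) (+-assoc q q i) ⟨
    v (p + p + i) xor v (q + q + i)  ∎
    where
    open ≡-Reasoning
    exchange : ∀ p q i → p + (q + i) ≡ q + (p + i)
    exchange = solve-∀

  open Endo Sequence using () renaming (_^_ to _^∘_; ^-homo to ^∘-homo)

  -- Each squaring of xᵖ + x^q loses its cross terms in characteristic 2.
  shifts-iterate : ∀ p q l v → (shifts p q ^∘ (2 ^ l)) v ≗ shifts (2 ^ l * p) (2 ^ l * q) v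
  shifts-iterate p q zero    v i rewrite +-identityʳ p | +-identityʳ q = refl
  shifts-iterate p q (suc l) v i = begin
    (shifts p q ^∘ (2 ^ suc l)) v i
      ≡⟨ cong (λ e → (shifts p q ^∘ (2 ^ l + e)) v i) (+-identityʳ (2 ^ l)) ⟩
    (shifts p q ^∘ (2 ^ l + 2 ^ l)) v i
      ≡⟨ cong (λ f → f v i) (^∘-homo (shifts p q) (2 ^ l) (2 ^ l)) ⟩
    (shifts p q ^∘ (2 ^ l)) ((shifts p q ^∘ (2 ^ l)) v) i
      ≡⟨ shifts-iterate p q l _ i ⟩
    shifts P Q ((shifts p q ^∘ (2 ^ l)) v) i
      ≡⟨ shifts-cong P Q (shifts-iterate p q l v) i ⟩
    shifts P Q (shifts P Q v) i
      ≡⟨ shifts-square P Q v i ⟩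
    shifts (P + P) (Q + Q) v i
      ≡⟨ cong₂ (λ p q → shifts p q v i) (double (2 ^ l) p) (double (2 ^ l) q) ⟩
    shifts (2 ^ suc l * p) (2 ^ suc l * q) v i  ∎
    where
    open ≡-Reasoning
    P = 2 ^ l * p
    Q = 2 ^ l * q
    double : ∀ e p → e * p + e * p ≡ (e + (e + 0)) * p
    double = solve-∀

  ∑odd : ℕ → Sequence → Bool
  ∑odd N v = F₂.sum-syntax N λ k → v (suc (toℕ k * 2))

  ∑odd-cong : ∀ N {v w} → v ≗ w → ∑odd N v ≡ ∑odd N w
  ∑odd-cong zero    v≗w = refl
  ∑odd-cong (suc N) v≗w = cong₂ _xor_ (v≗w 1) (∑odd-cong N (λ i → v≗w (2 + i)))

  ∑odd-⊕ : ∀ N v w → ∑odd N (v ⊕ w) ≡ ∑odd N v xor ∑odd N w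
  ∑odd-⊕ zero    v w = refl
  ∑odd-⊕ (suc N) v w = trans
    (cong ((v 1 xor w 1) xor_) (∑odd-⊕ N (λ i → v (2 + i)) (λ i → w (2 + i))))
    (solve 4 (λ a b c d → (a :+ b) :+ (c :+ d) := (a :+ c) :+ (b :+ d)) refl
      (v 1) (w 1) (∑odd N (λ i → v (2 + i))) (∑odd N (λ i → w (2 + i))))

  -- At the odd index 2k + 1 the hypothesis involves w at 2k and 2k + 2, so consecutive terms share
  -- a summand.
  ∑odd-telescopes : ∀ N (v w : Sequence) → (∀ i → v (suc i) ≡ w (2 + i) xor w i) →
    ∑odd N v ≡ w 0 xor w (N * 2)
  ∑odd-telescopes zero    v w eq = sym (xor-same (w 0))
  ∑odd-telescopes (suc N) v w eq = trans
    (cong₂ _xor_ (eq 0) (∑odd-telescopes N (λ i → v (2 + i)) (λ i → w (2 + i)) (λ i → eq (2 + i))))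
    (solve 3 (λ a b c → (b :+ a) :+ (b :+ c) := a :+ c) refl (w 0) (w 2) (w (2 + N * 2)))

  -- For h = 2 (N + 1) the range 1 ≤ i ≤ h - 1 has `suc (N * 2)` members; two of them are consumed
  -- per step, the even one contributing 0.
  ∑-odd-terms : ∀ N (v : Sequence) →
    (F₂.sum-syntax (suc (N * 2)) λ j → let i = suc (toℕ j) in if i % 2 ≡ᵇ 1 then v i else F₂.0#)
      ≡ ∑odd (suc N) v
  ∑-odd-terms zero    v = refl
  ∑-odd-terms (suc N) v = cong (v 1 xor_) (∑-odd-terms N (λ i → v (2 + i)))

  -- The group algebra 𝔽₂[ℤ/n] acts on n-periodic sequences by shifts; z below is
  -- x + x⁻¹, where x⁻¹ is the shift by m = n − 1.
  module EvenSequences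
    (n m h N l : ℕ) (n≡1+m : n ≡ suc m) (n≡h+h : n ≡ h + h) (h≡2N : h ≡ N * 2) (h≡2^l : h ≡ 2 ^ l) where

    private instance
      n≢0 : NonZero n
      n≢0 rewrite n≡1+m = _

    -- The symmetry v(-i) = v(i) on ℤ/n without subtraction. Periodicity is included, since
    -- congruent indices have a common negative.
    Even : Sequence → Set
    Even v = ∀ i j k → i + j ≡ k * n → v i ≡ v j

    -- The values at 0, ..., h - 1 determine such a sequence, which gives dimension h, the length of
    -- 𝔽₂[z]/(zʰ).
    Even₀ : Sequence → Set
    Even₀ v = Even v × v h ≡ false

    -- Since m is -1 modulo n, `m * i` is a negative of both i and n + i.
    even⇒periodic : ∀ {v} → Even v → ∀ i → v (n + i) ≡ v i
    even⇒periodic {v} even i = trans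
      (even (n + i) (m * i) (suc i) (trans (cong (λ n → n + i + m * i) n≡1+m)
        (trans (lemma m i) (cong (suc i *_) (sym n≡1+m)))))
      (sym (even i (m * i) i (trans (lemma′ m i) (cong (i *_) (sym n≡1+m)))))
      where
      lemma : ∀ m i → suc m + i + m * i ≡ suc i * suc m
      lemma = solve-∀
      lemma′ : ∀ m i → i + m * i ≡ i * suc m
      lemma′ = solve-∀

    even-% : ∀ {v} → Even v → ∀ i → v i ≡ v (i % n)
    even-% {v} even i = trans (cong v (m≡m%n+[m/n]*n i n)) (periods (i / n))
      where
      periods : ∀ k → v (i % n + k * n) ≡ v (i % n)
      periods zero    = cong v (+-identityʳ (i % n))
      periods (suc k) = trans (cong v (lemma (i % n) n (k * n))) (trans (even⇒periodic even _) (periods k))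
        where
        lemma : ∀ r n s → r + (n + s) ≡ n + (r + s)
        lemma = solve-∀

    even-≗ : ∀ {v w} → Even v → Even w → (∀ i → i ≤ h → v i ≡ w i) → v ≗ w
    even-≗ {v} {w} ev ew eq i = trans (even-% ev i) (trans (agree (i % n) (m%n<n i n)) (sym (even-% ew i)))
      where
      agree : ∀ r → r < n → v r ≡ w r
      agree r r<n with r ≤? h
      ... | yes r≤h = eq r r≤h
      ... | no  r≰h = trans (ev r (n ∸ r) 1 n-r) (trans (eq (n ∸ r) n-r≤h) (sym (ew r (n ∸ r) 1 n-r)))
        where
        n-r : r + (n ∸ r) ≡ 1 * n
        n-r = trans (m+[n∸m]≡n (<⇒≤ r<n)) (sym (*-identityˡ n))
        n-r≤h : n ∸ r ≤ h
        n-r≤h = m≤n+o⇒m∸n≤o n r (≤-trans (≤-reflexive n≡h+h) (+-monoˡ-≤ h (<⇒≤ (≰⇒> r≰h))))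

    z : Sequence → Sequence
    z = shifts 1 m

    z-even : ∀ {v} → Even v → Even (z v)
    z-even {v} even i j k eq = trans
      (solve 2 (λ a b → a :+ b := b :+ a) refl (v (suc i)) (v (m + i)))
      (cong₂ _xor_
        (even (m + i) (suc j) (suc k) (trans (lemma m i j) (cong₂ _+_ (sym n≡1+m) eq)))
        (even (suc i) (m + j) (suc k) (trans (lemma′ m i j) (cong₂ _+_ (sym n≡1+m) eq))))
      where
      lemma : ∀ m i j → m + i + suc j ≡ suc m + (i + j)
      lemma = solve-∀
      lemma′ : ∀ m i j → suc i + (m + j) ≡ suc m + (i + j)
      lemma′ = solve-∀

    xor-≡ : ∀ {a b} → a ≡ b → a xor b ≡ false
    xor-≡ {a} refl = xor-same a

    z-at-0 : ∀ {v} → Even v → z v 0 ≡ false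
    z-at-0 even = xor-≡ (even 1 (m + 0) 1 (trans (lemma m) (cong (1 *_) (sym n≡1+m))))
      where
      lemma : ∀ m → 1 + (m + 0) ≡ 1 * suc m
      lemma = solve-∀

    -- h is its own negative, so its two neighbours are negatives of each other and cancel.
    z-at-h : ∀ {v} → Even v → z v h ≡ false
    z-at-h even = xor-≡ (even (1 + h) (m + h) 2 (trans (lemma m h) (cong₂ (λ a b → a + (b + 0)) (sym n≡1+m) (sym n≡h+h))))
      where
      lemma : ∀ m h → 1 + h + (m + h) ≡ suc m + (h + h + 0)
      lemma = solve-∀

    z-even₀ : ∀ {v} → Even₀ v → Even₀ (z v)
    z-even₀ (even , _) = z-even even , z-at-h even

    ⊕-even₀ : ∀ {v w} → Even₀ v → Even₀ w → Even₀ (v ⊕ w)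
    ⊕-even₀ (ev , v₀) (ew , w₀) = (λ i j k eq → cong₂ _xor_ (ev i j k eq) (ew i j k eq)) , cong₂ _xor_ v₀ w₀

    z^-even₀ : ∀ {v} k → Even₀ v → Even₀ ((z ^∘ k) v)
    z^-even₀ zero    v₀ = v₀
    z^-even₀ (suc k) v₀ = z-even₀ (z^-even₀ k v₀)

    z^-cong : ∀ k {v w} → v ≗ w → (z ^∘ k) v ≗ (z ^∘ k) w
    z^-cong zero    v≗w = v≗w
    z^-cong (suc k) v≗w = shifts-cong 1 m (z^-cong k v≗w)

    z^-⊕ : ∀ k v w → (z ^∘ k) (v ⊕ w) ≗ (z ^∘ k) v ⊕ (z ^∘ k) w
    z^-⊕ zero    v w i = refl
    z^-⊕ (suc k) v w i = trans (shifts-cong 1 m (z^-⊕ k v w) i) (shifts-⊕ 1 m ((z ^∘ k) v) ((z ^∘ k) w) i)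

    z^-suc : ∀ k v → (z ^∘ k) (z v) ≡ (z ^∘ suc k) v
    z^-suc zero    v = refl
    z^-suc (suc k) v = cong z (z^-suc k v)

    -- As h is a power of 2, zʰ = xʰ + x⁻ʰ, and the two shifts agree because 2h = n; j below is a
    -- common negative of both shifted indices.
    z^h≗0 : ∀ {v} → Even v → ∀ i → (z ^∘ h) v i ≡ false
    z^h≗0 {v} even i = begin
      (z ^∘ h) v i                         ≡⟨ cong (λ e → (z ^∘ e) v i) h≡2^l ⟩
      (z ^∘ (2 ^ l)) v i                   ≡⟨ shifts-iterate 1 m l v i ⟩
      shifts (2 ^ l * 1) (2 ^ l * m) v i   ≡⟨ cong (λ e → shifts (e * 1) (e * m) v i) h≡2^l ⟨
      v (h * 1 + i) xor v (h * m + i)      ≡⟨ xor-≡ (trans (even _ j (1 + i) e₁) (sym (even _ j (h + i) e₂))) ⟩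
      false                                ∎
      where
      open ≡-Reasoning
      j = h + m * i
      e₁ : h * 1 + i + j ≡ (1 + i) * n
      e₁ = trans (lemma h m i) (cong₂ (λ a b → a + i * b) (sym n≡h+h) (sym n≡1+m))
        where
        lemma : ∀ h m i → h * 1 + i + (h + m * i) ≡ (h + h) + i * suc m
        lemma = solve-∀
      e₂ : h * m + i + j ≡ (h + i) * n
      e₂ = trans (lemma h m i) (cong ((h + i) *_) (sym n≡1+m))
        where
        lemma : ∀ h m i → h * m + i + (h + m * i) ≡ (h + i) * suc m
        lemma = solve-∀

    xor-insert : ∀ a b → a ≡ b xor (a xor b)
    xor-insert = solve 2 (λ a b → a := b :+ (a :+ b)) refl

    -- A solution w of v = z w is found by descending from w h = w (h − 1) = 0;
    -- `antidifference v c` is its value at distance c from h.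
    antidifference : Sequence → ℕ → Bool
    antidifference v 0             = false
    antidifference v 1             = false
    antidifference v (suc (suc c)) = v (h ∸ suc c) xor antidifference v c

    -- The recurrence is needed only strictly between 0 and h. At 0 and h both sides vanish, the
    -- right one by evenness of w.
    z-surjective : ∀ {v} → Even₀ v → v 0 ≡ false → ∃ λ w → Even₀ w × v ≗ z w
    z-surjective {v} (ev , vh≡0) v0≡0 = w , (ew , wh≡0) , even-≗ ev (z-even ew) agree
      where
      w : Sequence
      -- Dependence on the distance from i mod n to h alone makes w periodic and symmetric about h,
      -- hence even.
      w i = antidifference v ∣ i % n - h ∣
      ew : Even w
      ew i j k eq with complementary-residues n i j k eq
      ... | inj₁ (i%n≡0 , j%n≡0) = cong (λ r → antidifference v ∣ r - h ∣) (trans i%n≡0 (sym j%n≡0))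
      ... | inj₂ sum≡n = cong (antidifference v) (∣-∣-complementary (i % n) (j % n) h (trans sum≡n n≡h+h))
      h>0 : 0 < h
      h>0 = subst (0 <_) (sym h≡2^l) (m^n>0 2 l)
      h<n : h < n
      h<n = subst (h <_) (sym n≡h+h) (m<m+n h h>0)
      w-below : ∀ i c → i + c ≡ h → w i ≡ antidifference v c
      w-below i c i+c≡h = cong (antidifference v) (begin
        ∣ i % n - h ∣      ≡⟨ cong ∣_- h ∣ (m<n⇒m%n≡m (≤-<-trans (m+n≤o⇒m≤o i (≤-reflexive i+c≡h)) h<n)) ⟩
        ∣ i - h ∣          ≡⟨ cong ∣ i -_∣ i+c≡h ⟨
        ∣ i - i + c ∣      ≡⟨ ∣m-m+n∣≡n i c ⟩
        c                  ∎)
        where open ≡-Reasoning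
      wh≡0 : w h ≡ false
      wh≡0 = w-below h 0 (+-identityʳ h)
      interior : ∀ i c → i + suc (suc c) ≡ h → v (suc i) ≡ z w (suc i)
      interior i c eq = begin
        v (suc i)                             ≡⟨ cong v (m+n∸n≡m (suc i) (suc c)) ⟨
        v (suc i + suc c ∸ suc c)             ≡⟨ cong (λ t → v (t ∸ suc c)) (trans (sym (+-suc i (suc c))) eq) ⟩
        v (h ∸ suc c)                         ≡⟨ xor-insert (v (h ∸ suc c)) (antidifference v c) ⟩
        antidifference v c xor antidifference v (2 + c)
                                              ≡⟨ cong₂ _xor_ (w-below (2 + i) c (trans (lemma i c) eq)) (w-below i (2 + c) eq) ⟨
        w (2 + i) xor w i                     ≡⟨ cong (w (2 + i) xor_) (even⇒periodic ew i) ⟨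
        w (2 + i) xor w (n + i)               ≡⟨ cong (λ t → w (2 + i) xor w t) (trans (cong (_+ i) n≡1+m) (sym (+-suc m i))) ⟩
        w (2 + i) xor w (m + suc i)           ∎
        where
        open ≡-Reasoning
        lemma : ∀ i c → 2 + i + c ≡ i + suc (suc c)
        lemma = solve-∀
      agree : ∀ i → i ≤ h → v i ≡ z w i
      agree zero    _ = trans v0≡0 (sym (z-at-0 ew))
      agree (suc i) i<h with m≤n⇒m<n∨m≡n i<h
      ... | inj₂ refl = trans vh≡0 (sym (z-at-h ew))
      ... | inj₁ 1+i<h = interior i (h ∸ suc (suc i)) (trans (lemma i _) (m+[n∸m]≡n 1+i<h))
        where
        lemma : ∀ i c → i + suc (suc c) ≡ suc (suc i) + c
        lemma = solve-∀

    -- Telescoping runs from 0 to 2N = h, where w vanishes. So the odd sum reads off the coefficient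
    -- of z.
    ∑odd-z : ∀ {w} → Even₀ w → ∑odd N (z w) ≡ w 0
    ∑odd-z {w} (ew , wh≡0) = begin
      ∑odd N (z w)         ≡⟨ ∑odd-telescopes N (z w) w (λ i → cong (w (2 + i) xor_)
                                (trans (cong w (trans (+-suc m i) (cong (_+ i) (sym n≡1+m)))) (even⇒periodic ew i))) ⟩
      w 0 xor w (N * 2)    ≡⟨ cong (λ t → w 0 xor w t) h≡2N ⟨
      w 0 xor w h          ≡⟨ cong (w 0 xor_) wh≡0 ⟩
      w 0 xor false        ≡⟨ xor-identityʳ (w 0) ⟩
      w 0                  ∎
      where open ≡-Reasoning

    -- Divisibility by zᵏ inside `Even₀`. The cofactor is kept, because its value at 0 is the
    -- coefficient to be removed next.
    Order≥ : ℕ → Sequence → Set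
    Order≥ k v = ∃ λ w → Even₀ w × v ≗ (z ^∘ k) w

    order≥-suc : ∀ k {v w} → Even₀ w → w 0 ≡ false → v ≗ (z ^∘ k) w → Order≥ (suc k) v
    order≥-suc k {v} {w} w₀ w0≡0 v≗ = u , proj₁ (proj₂ solution) , v≗z^u
      where
      solution : ∃ λ u → Even₀ u × w ≗ z u
      solution = z-surjective w₀ w0≡0
      u : Sequence
      u = proj₁ solution
      v≗z^u : v ≗ (z ^∘ suc k) u
      v≗z^u i = begin
        v i                 ≡⟨ v≗ i ⟩
        (z ^∘ k) w i        ≡⟨ z^-cong k (proj₂ (proj₂ solution)) i ⟩
        (z ^∘ k) (z u) i    ≡⟨ cong (λ f → f i) (z^-suc k u) ⟩
        (z ^∘ suc k) u i    ∎
        where open ≡-Reasoning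

    order≥2 : ∀ {v} → Even₀ v → v 0 ≡ false → ∑odd N v ≡ false → Order≥ 2 v
    order≥2 {v} v₀ v0≡0 ∑≡0 = order≥-suc 1 w₀ (trans (sym (∑odd-z w₀)) (trans (sym (∑odd-cong N v≗zw)) ∑≡0)) v≗zw
      where
      solution : ∃ λ w → Even₀ w × v ≗ z w
      solution = z-surjective v₀ v0≡0
      w : Sequence
      w = proj₁ solution
      w₀ : Even₀ w
      w₀ = proj₁ (proj₂ solution)
      v≗zw : v ≗ z w
      v≗zw = proj₂ (proj₂ solution)

    order≥h : ∀ {v} → Order≥ h v → ∀ i → v i ≡ false
    order≥h (w , (even , _) , v≗) i = trans (v≗ i) (z^h≗0 even i)

    -- Multiplying a by the norm 1 + zᵏ + z²ᵏ⁻¹ of 1 + (1 + x) zᵏ⁻¹ removes a term zᵏ.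
    order≥-step : ∀ k {v w a} → Even₀ w → v ≗ (z ^∘ suc (suc k)) w → w 0 ≡ true → Even₀ a → a 0 ≡ true →
      Order≥ (suc (suc (suc k))) (v ⊕ ((z ^∘ suc (suc k)) a ⊕ (z ^∘ suc (suc k)) ((z ^∘ suc k) a)))
    order≥-step k {v} {w} {a} w₀ v≗ w0≡1 a₀ a0≡1 = order≥-suc (2 + k) u₀ u0≡0 v+≗
      where
      u : Sequence
      -- With K = k + 2, the terms z^K a and z^(2K-1) a have the common factor z^K, leaving a +
      -- z^(K-1) a.
      u = w ⊕ (a ⊕ (z ^∘ suc k) a)
      u₀ : Even₀ u
      u₀ = ⊕-even₀ w₀ (⊕-even₀ a₀ (z^-even₀ (suc k) a₀))
      u0≡0 : u 0 ≡ false
      -- The values are 1 + 1 + 0; the last is 0 because K - 1 ≥ 1 and multiples of z vanish at 0.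
      u0≡0 = cong₂ _xor_ w0≡1 (cong₂ _xor_ a0≡1 (z-at-0 {(z ^∘ k) a} (proj₁ (z^-even₀ k a₀))))
      v+≗ : v ⊕ ((z ^∘ suc (suc k)) a ⊕ (z ^∘ suc (suc k)) ((z ^∘ suc k) a)) ≗ (z ^∘ suc (suc k)) u
      v+≗ i = begin
        v i xor ((z ^∘ suc (suc k)) a i xor (z ^∘ suc (suc k)) ((z ^∘ suc k) a) i)
          ≡⟨ cong₂ _xor_ (v≗ i) (sym (z^-⊕ (suc (suc k)) a ((z ^∘ suc k) a) i)) ⟩
        (z ^∘ suc (suc k)) w i xor (z ^∘ suc (suc k)) (a ⊕ (z ^∘ suc k) a) i
          ≡⟨ z^-⊕ (suc (suc k)) w (a ⊕ (z ^∘ suc k) a) i ⟨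
        (z ^∘ suc (suc k)) u i  ∎
        where open ≡-Reasoning

open BinarySequences

-- Counting with bit vectors

encode : ∀ {n} → Vector Bool n → Fin (2 ℕ.^ n)
encode k = Fin.funToFin (Inverse.from Fin.2↔Bool ∘ k)

encode-injective : ∀ {n} {k k′ : Vector Bool n} → encode k ≡ encode k′ → k ≗ k′
encode-injective {n} {k} {k′} eq i = ≡.trans (≡.sym (strictlyInverseˡ (k i)))
  (≡.trans (≡.cong to (≡.trans (≡.sym (Fin.finToFun-funToFin (from ∘ k) i))
    (≡.trans (≡.cong (λ j → Fin.finToFun j i) eq) (Fin.finToFun-funToFin (from ∘ k′) i))))
  (strictlyInverseˡ (k′ i)))
  where open Inverse Fin.2↔Bool

-- A missed value could be punched out, leaving an injection into a smaller set.
injective⇒surjective : ∀ {n} (f : Fin n → Fin n) → Injective _≡_ _≡_ f → ∀ y → ∃ λ x → f x ≡ y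
injective⇒surjective {suc n} f inj y with Fin.any? (λ x → f x Fin.≟ y)
... | yes hit = hit
... | no miss = contradiction
  (Fin.injective⇒≤ {f = λ x → Fin.punchOut (λ eq → miss (x , ≡.sym eq))}
    (λ {a} {b} eq → inj (Fin.punchOut-injective (λ e → miss (a , ≡.sym e)) (λ e → miss (b , ≡.sym e)) eq)))
  ℕ.1+n≰n

module _ {c ℓ} (M : CommutativeMonoid c ℓ) where
  open CommutativeMonoid M
  open CMSum M

  sum-single : ∀ {n} (i : Fin n) (t : Vector Carrier n) → (∀ j → j ≢ i → t j ≈ ε) → sum t ≈ t i
  sum-single {suc n} zero t off = trans (∙-congˡ (trans (sum-cong-≋ (λ j → off (suc j) λ ())) (sum-replicate-zero n))) (identityʳ _)
  sum-single {suc n} (suc i) t off = trans (∙-congʳ (off zero λ ()))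
    (trans (identityˡ _) (sum-single i (t ∘ suc) (λ j j≢i → off (suc j) (j≢i ∘ Fin.suc-injective))))

-- Arithmetic of a field of order 2ⁿ

module FiniteField {c ℓ₁ ℓ₂} (F : HeytingField c ℓ₁ ℓ₂) (n : ℕ) (order : HasOrder F (2 ℕ.^ n)) where

  open CommutativeRing (commutativeRing F) public hiding (zero)
  open Extension F public
  open Exp commutativeSemiring public
  open SemiringSum semiring public
  open import Relation.Binary.Reasoning.Setoid setoid
  private
    module HF = HeytingField F
    module HP = HeytingProperties HF.heytingCommutativeRing
  open Inverse order using (to; from; to-cong; strictlyInverseˡ; strictlyInverseʳ)

  q : ℕ
  q = 2 ℕ.^ n

  index : Carrier → Fin q
  index = to

  index-cong : ∀ {x y} → x ≈ y → index x ≡ index y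
  index-cong = to-cong

  element : Fin q → Carrier
  element = from

  element-injective : ∀ {i j} → element i ≈ element j → i ≡ j
  element-injective {i} {j} eq = ≡.trans (≡.sym (strictlyInverseˡ i)) (≡.trans (to-cong eq) (strictlyInverseˡ j))

  index-injective : ∀ {x y} → index x ≡ index y → x ≈ y
  index-injective {x} {y} eq = trans (sym (strictlyInverseʳ x)) (trans (reflexive (≡.cong from eq)) (strictlyInverseʳ y))

  infix 4 _≟_
  _≟_ : ∀ x y → Dec (x ≈ y)
  x ≟ y = map′ index-injective index-cong (index x Fin.≟ index y)

  ∃? : ∀ {p} {P : Carrier → Set p} → (∀ {x y} → x ≈ y → P x → P y) → (∀ x → Dec (P x)) → Dec (∃ P)
  ∃? resp P? = map′ (λ (i , p) → from i , p) (λ (x , p) → index x , resp (sym (strictlyInverseʳ x)) p) (Fin.any? (P? ∘ from))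

  -- Exhaustive search decides whether an inverse exists. If none does, x is not apart from 0, and
  -- tightness makes it equal to 0.
  inverse : ∀ {x} → ¬ (x ≈ 0#) → ∃ λ y → x * y ≈ 1#
  inverse {x} x≉0 with ∃? (λ y≈z xy≈1 → trans (*-congˡ (sym y≈z)) xy≈1) (λ y → x * y ≟ 1#)
  ... | yes x⁻¹ = x⁻¹
  ... | no ∄x⁻¹ = contradiction (proj₁ (HF.tight x 0#) (λ x#0 → case HF.#⇒invertible x#0 of
          λ (y , _ , xy≈1) → ∄x⁻¹ (y , trans (*-congʳ (sym (HP.x-0≈x x))) xy≈1))) x≉0

  1≉0 : ¬ (1# ≈ 0#)
  1≉0 1≈0 = HF.#-irrefl 1≈0 HP.1#0

  *-cancelˡ-≉0 : ∀ {x y z} → ¬ (x ≈ 0#) → x * y ≈ x * z → y ≈ z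
  *-cancelˡ-≉0 {x} {y} {z} x≉0 xy≈xz with inverse x≉0
  ... | w , xw≈1 = begin
    y            ≈⟨ undo y ⟨
    w * (x * y)  ≈⟨ *-congˡ xy≈xz ⟩
    w * (x * z)  ≈⟨ undo z ⟩
    z            ∎
    where
    undo : ∀ t → w * (x * t) ≈ t
    undo t = trans (sym (*-assoc w x t)) (trans (*-congʳ (trans (*-comm w x) xw≈1)) (*-identityˡ t))

  *-≉0 : ∀ {x y} → ¬ (x ≈ 0#) → ¬ (y ≈ 0#) → ¬ (x * y ≈ 0#)
  *-≉0 {x} x≉0 y≉0 xy≈0 = y≉0 (*-cancelˡ-≉0 x≉0 (trans xy≈0 (sym (zeroʳ x))))

  module _ {a b} (M : CommutativeMonoid a b) where
    private module M = CommutativeMonoid M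
    open CMSum M using () renaming (sum to sumM; sum-cong-≋ to sumM-cong; sum-permute to sumM-permute)

    -- Stated for any commutative monoid, since it serves both + under translations and * under
    -- multiplication by a unit.
    sum-reindex : (g g⁻¹ : Carrier → Carrier) → (∀ {x y} → x ≈ y → g x ≈ g y) → (∀ {x y} → x ≈ y → g⁻¹ x ≈ g⁻¹ y) →
      (∀ x → g (g⁻¹ x) ≈ x) → (∀ x → g⁻¹ (g x) ≈ x) →
      (f : Carrier → M.Carrier) → (∀ {x y} → x ≈ y → f x M.≈ f y) →
      sumM (f ∘ from) M.≈ sumM (f ∘ g ∘ from)
    sum-reindex g g⁻¹ g-cong g⁻¹-cong gg⁻¹ g⁻¹g f f-cong =
      M.trans (sumM-permute (f ∘ from) π) (sumM-cong (λ i → f-cong (strictlyInverseʳ (g (from i)))))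
      where
      roundtrip : (u v : Carrier → Carrier) → (∀ {x y} → x ≈ y → u x ≈ u y) → (∀ x → u (v x) ≈ x) →
        ∀ i → to (u (from (to (v (from i))))) ≡ i
      roundtrip u v u-cong uv i = ≡.trans (to-cong (trans (u-cong (strictlyInverseʳ (v (from i)))) (uv (from i)))) (strictlyInverseˡ i)
      π : Permutation q q
      π = permutation (to ∘ g ∘ from) (to ∘ g⁻¹ ∘ from) (roundtrip g g⁻¹ g-cong gg⁻¹) (roundtrip g⁻¹ g g⁻¹-cong g⁻¹g)

  module × = Mult semiring

  -- q · 1 = 0 with q a power of 2, and F has no zero divisors.
  1+1≈0 : 1# + 1# ≈ 0#
  1+1≈0 = decidable-stable (1# + 1# ≟ 0#) (λ 2≉0 → power n 2≉0 q×1≈0)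
    where
    -- Translation by 1 permutes F, so ∑ x = ∑ (x + 1).
    S : Carrier
    S = sum from
    undo₁ : ∀ x → x + - 1# + 1# ≈ x
    undo₁ x = trans (+-assoc x _ _) (trans (+-congˡ (-‿inverseˡ 1#)) (+-identityʳ x))
    undo₂ : ∀ x → x + 1# + - 1# ≈ x
    undo₂ x = trans (+-assoc x _ _) (trans (+-congˡ (-‿inverseʳ 1#)) (+-identityʳ x))
    q×1≈0 : q ×.× 1# ≈ 0#
    q×1≈0 = GroupProperties.∙-cancelˡ +-group S _ _ (begin
      S + q ×.× 1#                 ≈⟨ +-congˡ (sum-replicate q) ⟨
      S + ∑[ i < q ] 1#            ≈⟨ ∑-distrib-+ from (λ _ → 1#) ⟨
      ∑[ i < q ] (from i + 1#)     ≈⟨ sum-reindex +-commutativeMonoid (_+ 1#) (_+ - 1#) +-congʳ +-congʳ undo₁ undo₂ (λ x → x) (λ e → e) ⟨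
      S                            ≈⟨ +-identityʳ S ⟨
      S + 0#                       ∎)
    power : ∀ k → ¬ (1# + 1# ≈ 0#) → ¬ ((2 ℕ.^ k) ×.× 1# ≈ 0#)
    power zero    2≉0 e = 1≉0 (trans (sym (+-identityʳ 1#)) e)
    power (suc k) 2≉0 e = *-≉0 (λ e′ → 2≉0 (trans (+-congˡ (sym (+-identityʳ 1#))) e′)) (power k 2≉0)
      (trans (sym (×.×1-homo-* 2 (2 ℕ.^ k))) e)

  x^q≈x : ∀ x → x ^ q ≈ x
  x^q≈x a with a ≟ 0#
  ... | yes a≈0 = trans (^-congˡ q a≈0) (trans (0^ q (ℕ.m^n>0 2 n)) (sym a≈0))
    where
    0^ : ∀ k → 0 ℕ.< k → 0# ^ k ≈ 0#
    0^ (suc k) _ = zeroˡ (0# ^ k)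
  ... | no a≉0 = begin
      -- Each of the q factors a is split as g x * k x: g gathers the q - 1 factors at nonzero x,
      -- and k holds the one at x = 0.
      a ^ q                          ≈⟨ ∏.sum-replicate q ⟨
      ∏ (λ _ → a)                    ≈⟨ ∏.sum-cong-≋ (λ i → gk (from i)) ⟨
      ∏ (λ i → g (from i) * k (from i)) ≈⟨ ∏.∑-distrib-+ (g ∘ from) (k ∘ from) ⟩
      ∏ (g ∘ from) * ∏ (k ∘ from)    ≈⟨ *-cong ∏g≈1 ∏k≈a ⟩
      1# * a                         ≈⟨ *-identityˡ a ⟩
      a                              ∎
    where
    module ∏ = CMSum *-commutativeMonoid
    ∏ : Vector Carrier q → Carrier
    ∏ = ∏.sum
    -- Multiplication by a permutes F and fixes 0. With f replacing the factor 0
    -- by 1, the product of all f x = ∏ f (a x) is nonzero and equals aᵠ⁻¹ ∏ f x.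
    f g k : Carrier → Carrier
    f x = if isYes (x ≟ 0#) then 1# else x
    g x = if isYes (x ≟ 0#) then 1# else a
    k x = if isYes (x ≟ 0#) then a else 1#
    f-cong : ∀ {x y} → x ≈ y → f x ≈ f y
    f-cong {x} {y} x≈y with x ≟ 0# | y ≟ 0#
    ... | yes _ | yes _ = refl
    ... | yes x≈0 | no y≉0 = contradiction (trans (sym x≈y) x≈0) y≉0
    ... | no x≉0 | yes y≈0 = contradiction (trans x≈y y≈0) x≉0
    ... | no _ | no _ = x≈y
    f≉0 : ∀ x → ¬ (f x ≈ 0#)
    f≉0 x with x ≟ 0#
    ... | yes _ = 1≉0
    ... | no x≉0 = x≉0
    fa : ∀ x → f (a * x) ≈ g x * f x
    fa x with x ≟ 0# | a * x ≟ 0#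
    ... | yes _ | yes _ = sym (*-identityˡ 1#)
    ... | yes x≈0 | no ax≉0 = contradiction (trans (*-congˡ x≈0) (zeroʳ a)) ax≉0
    ... | no x≉0 | yes ax≈0 = contradiction ax≈0 (*-≉0 a≉0 x≉0)
    ... | no _ | no _ = refl
    gk : ∀ x → g x * k x ≈ a
    gk x with x ≟ 0#
    ... | yes _ = *-identityˡ a
    ... | no _ = *-identityʳ a
    ∏-≉0 : ∀ {m} (t : Vector Carrier m) → (∀ i → ¬ (t i ≈ 0#)) → ¬ (∏.sum t ≈ 0#)
    ∏-≉0 {zero} t t≉0 = 1≉0
    ∏-≉0 {suc m} t t≉0 = *-≉0 (t≉0 zero) (∏-≉0 (t ∘ suc) (t≉0 ∘ suc))
    a⁻¹ : Carrier
    a⁻¹ = proj₁ (inverse a≉0)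
    aa⁻¹ : ∀ x → a * (a⁻¹ * x) ≈ x
    aa⁻¹ x = trans (sym (*-assoc a a⁻¹ x)) (trans (*-congʳ (proj₂ (inverse a≉0))) (*-identityˡ x))
    a⁻¹a : ∀ x → a⁻¹ * (a * x) ≈ x
    a⁻¹a x = trans (sym (*-assoc a⁻¹ a x)) (trans (*-congʳ (trans (*-comm a⁻¹ a) (proj₂ (inverse a≉0)))) (*-identityˡ x))
    ∏g≈1 : ∏ (g ∘ from) ≈ 1#
    ∏g≈1 = *-cancelˡ-≉0 (∏-≉0 (f ∘ from) (λ i → f≉0 (from i))) (begin
      ∏ (f ∘ from) * ∏ (g ∘ from)           ≈⟨ *-comm _ _ ⟩
      ∏ (g ∘ from) * ∏ (f ∘ from)           ≈⟨ ∏.∑-distrib-+ (g ∘ from) (f ∘ from) ⟨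
      ∏ (λ i → g (from i) * f (from i))     ≈⟨ ∏.sum-cong-≋ (λ i → fa (from i)) ⟨
      ∏ (λ i → f (a * from i))              ≈⟨ sum-reindex *-commutativeMonoid (a *_) (a⁻¹ *_) *-congˡ *-congˡ aa⁻¹ a⁻¹a f f-cong ⟨
      ∏ (f ∘ from)                          ≈⟨ *-identityʳ _ ⟨
      ∏ (f ∘ from) * 1#                     ∎)
    ∏k≈a : ∏ (k ∘ from) ≈ a
    ∏k≈a = trans (sum-single *-commutativeMonoid (index 0#) (k ∘ from) off) on
      where
      off : ∀ j → j ≢ index 0# → k (from j) ≈ 1#
      off j j≢ with from j ≟ 0#
      ... | yes e = contradiction (≡.trans (≡.sym (strictlyInverseˡ j)) (to-cong e)) j≢
      ... | no _ = refl
      on : k (from (index 0#)) ≈ a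
      on with from (index 0#) ≟ 0#
      ... | yes _ = refl
      ... | no e = contradiction (strictlyInverseʳ 0#) e

  +-self : ∀ x → x + x ≈ 0#
  +-self x = begin
    x + x              ≈⟨ +-cong (*-identityʳ x) (*-identityʳ x) ⟨
    x * 1# + x * 1#    ≈⟨ distribˡ x 1# 1# ⟨
    x * (1# + 1#)      ≈⟨ *-congˡ 1+1≈0 ⟩
    x * 0#             ≈⟨ zeroʳ x ⟩
    0#                 ∎

  ι-+ : ∀ a b → ι (a xor b) ≈ ι a + ι b
  ι-+ false b     = sym (+-identityˡ (ι b))
  ι-+ true  false = sym (+-identityʳ 1#)
  ι-+ true  true  = sym 1+1≈0

  ι-* : ∀ a b → ι (a ∧ b) ≈ ι a * ι b
  ι-* false b = sym (zeroˡ (ι b))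
  ι-* true  b = sym (*-identityˡ (ι b))

  private
    ι-morphism : CommutativeRing.rawRing Bool.xor-∧-commutativeRing -Raw-AlmostCommutative⟶ fromCommutativeSemiring commutativeSemiring
    ι-morphism = record
      { ⟦_⟧ = ι ; +-homo = ι-+ ; *-homo = ι-* ; -‿homo = λ _ → refl ; 0-homo = refl ; 1-homo = refl }

    coefficient≟ : ∀ a b → Maybe (ι a ≈ ι b)
    coefficient≟ a b with a Bool.≟ b
    ... | yes ≡.refl = just refl
    ... | no _ = nothing

  -- Coefficients in 𝔽₂ make the normal form cancel doubled terms, so identities special to
  -- characteristic 2 are proved by `solve`.
  module Char2Solver = RingSolver
    (CommutativeRing.rawRing Bool.xor-∧-commutativeRing) (fromCommutativeSemiring commutativeSemiring) ι-morphism coefficient≟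
  open Char2Solver using (solve; _:+_; _:*_; _:=_)

  x+y≈0⇒x≈y : ∀ {x y} → x + y ≈ 0# → x ≈ y
  x+y≈0⇒x≈y {x} {y} e = trans (solve 2 (λ x y → x := (x :+ y) :+ y) refl x y) (trans (+-congʳ e) (+-identityˡ y))

  idempotent⇒0∨1 : ∀ {x} → x * x ≈ x → x ≈ 0# ⊎ x ≈ 1#
  idempotent⇒0∨1 {x} xx≈x with x ≟ 0#
  ... | yes x≈0 = inj₁ x≈0
  ... | no  x≉0 = inj₂ (*-cancelˡ-≉0 x≉0 (trans xx≈x (sym (*-identityʳ x))))

  ι-injective : ∀ {a b} → ι a ≈ ι b → a ≡ b
  ι-injective {false} {false} _ = ≡.refl
  ι-injective {false} {true}  e = contradiction (sym e) 1≉0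
  ι-injective {true}  {false} e = contradiction e 1≉0
  ι-injective {true}  {true}  _ = ≡.refl

-- The Frobenius map, traces and the operator 1 + φ

module Frobenius {c ℓ₁ ℓ₂} (F : HeytingField c ℓ₁ ℓ₂) (n : ℕ) (order : HasOrder F (2 ℕ.^ n)) where

  open FiniteField F n order public
  open import Relation.Binary.Reasoning.Setoid setoid
  open Char2Solver using (solve; _:+_; _:*_; _:=_)

  sumℕ : ℕ → (ℕ → Carrier) → Carrier
  sumℕ N f = ∑[ i < N ] f (toℕ i)

  sumℕ-cong : ∀ N {f g} → (∀ i → f i ≈ g i) → sumℕ N f ≈ sumℕ N g
  sumℕ-cong N eq = sum-cong-≋ {N} (λ i → eq (toℕ i))

  sumℕ-+ : ∀ N f g → sumℕ N (λ i → f i + g i) ≈ sumℕ N f + sumℕ N g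
  sumℕ-+ N f g = ∑-distrib-+ {N} (f ∘ toℕ) (g ∘ toℕ)

  sumℕ-last : ∀ N f → sumℕ (suc N) f ≈ sumℕ N f + f N
  sumℕ-last zero    f = +-comm (f 0) 0#
  sumℕ-last (suc N) f = trans (+-congˡ (sumℕ-last N (f ∘ suc))) (sym (+-assoc _ _ _))

  sumℕ-split : ∀ M N f → sumℕ (M ℕ.+ N) f ≈ sumℕ M f + sumℕ N (λ i → f (M ℕ.+ i))
  sumℕ-split zero    N f = sym (+-identityˡ _)
  sumℕ-split (suc M) N f = trans (+-congˡ (sumℕ-split M N (f ∘ suc))) (sym (+-assoc _ _ _))

  sumℕ-reverse : ∀ N f g → (∀ i j → suc (i ℕ.+ j) ≡ N → f i ≈ g j) → sumℕ N f ≈ sumℕ N g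
  sumℕ-reverse zero    f g eq = refl
  sumℕ-reverse (suc N) f g eq = begin
    f 0 + sumℕ N (f ∘ suc)   ≈⟨ +-cong (eq 0 N ≡.refl) (sumℕ-reverse N (f ∘ suc) g (λ i j e → eq (suc i) j (≡.cong suc e))) ⟩
    g N + sumℕ N g           ≈⟨ +-comm _ _ ⟩
    sumℕ N g + g N           ≈⟨ sumℕ-last N g ⟨
    sumℕ (suc N) g           ∎

  sumℕ-pairs : ∀ N f → sumℕ (N ℕ.* 2) f ≈ sumℕ N (λ i → f (i ℕ.* 2) + f (suc (i ℕ.* 2)))
  sumℕ-pairs zero    f = refl
  sumℕ-pairs (suc N) f = trans (sym (+-assoc _ _ _)) (+-congˡ (sumℕ-pairs N (λ i → f (2 ℕ.+ i))))

  sumℕ-map : (g : Carrier → Carrier) → g 0# ≈ 0# → (∀ x y → g (x + y) ≈ g x + g y) →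
    ∀ N f → g (sumℕ N f) ≈ sumℕ N (g ∘ f)
  sumℕ-map g g0 g+ zero    f = g0
  sumℕ-map g g0 g+ (suc N) f = trans (g+ (f 0) _) (+-congˡ (sumℕ-map g g0 g+ N (f ∘ suc)))

  ι-sum : ∀ N (v : ℕ → Bool) → ι (F₂.sum-syntax N (v ∘ toℕ)) ≈ sumℕ N (ι ∘ v)
  ι-sum zero    v = refl
  ι-sum (suc N) v = trans (ι-+ (v 0) _) (+-congˡ (ι-sum N (v ∘ suc)))

  φ : ℕ → Carrier → Carrier
  φ i x = x ^ (2 ℕ.^ i)

  φ-cong : ∀ i {x y} → x ≈ y → φ i x ≈ φ i y
  φ-cong i = ^-congˡ (2 ℕ.^ i)

  φ-≡ : ∀ {i j} x → i ≡ j → φ i x ≈ φ j x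
  φ-≡ x ≡.refl = refl

  φ-0 : ∀ x → φ 0 x ≈ x
  φ-0 x = *-identityʳ x

  φ-suc : ∀ i x → φ (suc i) x ≈ φ i x * φ i x
  φ-suc i x = trans (^-homo-* x (2 ℕ.^ i) _) (*-congˡ (^-congʳ x (ℕ.+-identityʳ (2 ℕ.^ i))))

  φ-1 : ∀ x → φ 1 x ≈ x * x
  φ-1 x = *-congˡ (*-identityʳ x)

  φ-+ : ∀ i x y → φ i (x + y) ≈ φ i x + φ i y
  φ-+ zero    x y = trans (φ-0 _) (sym (+-cong (φ-0 x) (φ-0 y)))
  φ-+ (suc i) x y = begin
    φ (suc i) (x + y)                          ≈⟨ φ-suc i (x + y) ⟩
    φ i (x + y) * φ i (x + y)                  ≈⟨ *-cong (φ-+ i x y) (φ-+ i x y) ⟩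
    (φ i x + φ i y) * (φ i x + φ i y)          ≈⟨ solve 2 (λ a b → (a :+ b) :* (a :+ b) := a :* a :+ b :* b) refl (φ i x) (φ i y) ⟩
    φ i x * φ i x + φ i y * φ i y              ≈⟨ +-cong (φ-suc i x) (φ-suc i y) ⟨
    φ (suc i) x + φ (suc i) y                  ∎

  φ-* : ∀ i x y → φ i (x * y) ≈ φ i x * φ i y
  φ-* i x y = ^-distrib-* x y (2 ℕ.^ i)

  φ-0# : ∀ i → φ i 0# ≈ 0#
  φ-0# zero    = φ-0 0#
  φ-0# (suc i) = trans (φ-suc i 0#) (trans (*-congʳ (φ-0# i)) (zeroˡ _))

  φ-∘ : ∀ i j x → φ i (φ j x) ≈ φ (i ℕ.+ j) x
  φ-∘ i j x = trans (^-assocʳ x (2 ℕ.^ j) (2 ℕ.^ i))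
    (^-congʳ x (≡.trans (ℕ.*-comm (2 ℕ.^ j) _) (≡.sym (ℕ.^-distribˡ-+-* 2 i j))))

  φ-n : ∀ x → φ n x ≈ x
  φ-n = x^q≈x

  φ-kn : ∀ k x → φ (k ℕ.* n) x ≈ x
  φ-kn zero    x = φ-0 x
  φ-kn (suc k) x = trans (sym (φ-∘ n (k ℕ.* n) x)) (trans (φ-n _) (φ-kn k x))

  φ-sum : ∀ i N f → φ i (sumℕ N f) ≈ sumℕ N (φ i ∘ f)
  φ-sum i = sumℕ-map (φ i) (φ-0# i) (φ-+ i)

  -- ∑ φ^{jp} over j < N is the relative trace to the fixed field of φᵖ when N p = n.
  trace : ℕ → ℕ → Carrier → Carrier
  trace p N x = sumℕ N (λ j → φ (j ℕ.* p) x)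

  trace-cong : ∀ p N {x y} → x ≈ y → trace p N x ≈ trace p N y
  trace-cong p N x≈y = sumℕ-cong N (λ j → φ-cong (j ℕ.* p) x≈y)

  trace-+ : ∀ p N x y → trace p N (x + y) ≈ trace p N x + trace p N y
  trace-+ p N x y = trans (sumℕ-cong N (λ j → φ-+ (j ℕ.* p) x y)) (sumℕ-+ N (λ j → φ (j ℕ.* p) x) (λ j → φ (j ℕ.* p) y))

  trace-0# : ∀ p N → trace p N 0# ≈ 0#
  trace-0# p N = trans (sumℕ-cong N (λ j → φ-0# (j ℕ.* p))) (sum-replicate-zero N)

  trace-sum : ∀ p N M f → trace p N (sumℕ M f) ≈ sumℕ M (trace p N ∘ f)
  trace-sum p N = sumℕ-map (trace p N) (trace-0# p N) (trace-+ p N)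

  φ-trace : ∀ i p N x → φ i (trace p N x) ≈ trace p N (φ i x)
  φ-trace i p N x = trans (φ-sum i N (λ j → φ (j ℕ.* p) x)) (sumℕ-cong N (λ j → trans (φ-∘ i (j ℕ.* p) x)
    (trans (φ-≡ x (ℕ.+-comm i (j ℕ.* p))) (sym (φ-∘ (j ℕ.* p) i x)))))

  -- The summands move up cyclically: N + 1 terms are split at the front and at the back, and the
  -- end terms agree as φⁿ is the identity.
  trace-φ : ∀ p N → N ℕ.* p ≡ n → ∀ x → trace p N (φ p x) ≈ trace p N x
  trace-φ p N Np≡n x = GroupProperties.∙-cancelˡ +-group (φ 0 x) _ _ (begin
    φ 0 x + trace p N (φ p x)                        ≈⟨ +-congˡ (sumℕ-cong N (λ j → trans (φ-∘ (j ℕ.* p) p x) (φ-≡ x (ℕ.+-comm (j ℕ.* p) p)))) ⟩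
    sumℕ (suc N) (λ j → φ (j ℕ.* p) x)               ≈⟨ sumℕ-last N (λ j → φ (j ℕ.* p) x) ⟩
    trace p N x + φ (N ℕ.* p) x                      ≈⟨ +-comm _ _ ⟩
    φ (N ℕ.* p) x + trace p N x                      ≈⟨ +-congʳ (trans (φ-≡ x Np≡n) (trans (φ-n x) (sym (φ-0 x)))) ⟩
    φ 0 x + trace p N x                              ∎)

  trace-φ* : ∀ p N → N ℕ.* p ≡ n → ∀ k x → trace p N (φ (k ℕ.* p) x) ≈ trace p N x
  trace-φ* p N Np≡n zero    x = trace-cong p N (φ-0 x)
  trace-φ* p N Np≡n (suc k) x = begin
    trace p N (φ (p ℕ.+ k ℕ.* p) x)    ≈⟨ trace-cong p N (φ-∘ p (k ℕ.* p) x) ⟨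
    trace p N (φ p (φ (k ℕ.* p) x))    ≈⟨ trace-φ p N Np≡n _ ⟩
    trace p N (φ (k ℕ.* p) x)          ≈⟨ trace-φ* p N Np≡n k x ⟩
    trace p N x                        ∎

  Tr≈trace : ∀ x → Tr n x ≈ trace 1 n x
  Tr≈trace x = sumℕ-cong n (λ j → φ-≡ x (≡.sym (ℕ.*-identityʳ j)))

  Tr-cong : ∀ {x y} → x ≈ y → Tr n x ≈ Tr n y
  Tr-cong x≈y = sumℕ-cong n (λ j → φ-cong j x≈y)

  Tr-+ : ∀ x y → Tr n (x + y) ≈ Tr n x + Tr n y
  Tr-+ x y = trans (sumℕ-cong n (λ j → φ-+ j x y)) (sumℕ-+ n (λ j → φ j x) (λ j → φ j y))

  Tr-φ : ∀ i x → Tr n (φ i x) ≈ Tr n x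
  Tr-φ i x = begin
    Tr n (φ i x)                ≈⟨ Tr≈trace _ ⟩
    trace 1 n (φ i x)           ≈⟨ trace-cong 1 n (φ-≡ x (≡.sym (ℕ.*-identityʳ i))) ⟩
    trace 1 n (φ (i ℕ.* 1) x)   ≈⟨ trace-φ* 1 n (ℕ.*-identityʳ n) i x ⟩
    trace 1 n x                 ≈⟨ Tr≈trace x ⟨
    Tr n x                      ∎

  Tr-idempotent : ∀ x → Tr n x * Tr n x ≈ Tr n x
  Tr-idempotent x = begin
    Tr n x * Tr n x       ≈⟨ φ-1 _ ⟨
    φ 1 (Tr n x)          ≈⟨ φ-cong 1 (Tr≈trace x) ⟩
    φ 1 (trace 1 n x)     ≈⟨ φ-trace 1 1 n x ⟩
    trace 1 n (φ 1 x)     ≈⟨ Tr≈trace _ ⟨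
    Tr n (φ 1 x)          ≈⟨ Tr-φ 1 x ⟩
    Tr n x                ∎

  tr : Carrier → Bool
  tr x = isYes (Tr n x ≟ 1#)

  ι-tr : ∀ x → ι (tr x) ≈ Tr n x
  ι-tr x with Tr n x ≟ 1#
  ... | yes e = sym e
  ... | no ¬e = [ sym , (λ e → contradiction e ¬e) ]′ (idempotent⇒0∨1 (Tr-idempotent x))

  tr-≡ : ∀ {x y} → Tr n x ≈ Tr n y → tr x ≡ tr y
  tr-≡ {x} {y} e = ι-injective (trans (ι-tr x) (trans e (sym (ι-tr y))))

  tr-cong : ∀ {x y} → x ≈ y → tr x ≡ tr y
  tr-cong = tr-≡ ∘ Tr-cong

  tr-+ : ∀ x y → tr (x + y) ≡ tr x xor tr y
  tr-+ x y = ι-injective (begin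
    ι (tr (x + y))         ≈⟨ ι-tr _ ⟩
    Tr n (x + y)           ≈⟨ Tr-+ x y ⟩
    Tr n x + Tr n y        ≈⟨ +-cong (ι-tr x) (ι-tr y) ⟨
    ι (tr x) + ι (tr y)    ≈⟨ ι-+ (tr x) (tr y) ⟨
    ι (tr x xor tr y)      ∎)

  tr-φ : ∀ i x → tr (φ i x) ≡ tr x
  tr-φ i x = tr-≡ (Tr-φ i x)

  y : Carrier → Carrier
  y x = x + φ 1 x

  y-cong : ∀ {a b} → a ≈ b → y a ≈ y b
  y-cong e = +-cong e (φ-cong 1 e)

  y-+ : ∀ a b → y (a + b) ≈ y a + y b
  y-+ a b = trans (+-congˡ (φ-+ 1 a b)) (solve 4 (λ a b c d → (a :+ b) :+ (c :+ d) := (a :+ c) :+ (b :+ d)) refl a b (φ 1 a) (φ 1 b))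

  tr-y : ∀ a → tr (y a) ≡ false
  tr-y a = ≡.trans (tr-+ a (φ 1 a)) (≡.trans (≡.cong (tr a xor_) (tr-φ 1 a)) (Bool.xor-same (tr a)))

  ker-y : ∀ {a} → y a ≈ 0# → a ≈ 0# ⊎ a ≈ 1#
  ker-y ya≈0 = idempotent⇒0∨1 (trans (sym (φ-1 _)) (sym (x+y≈0⇒x≈y ya≈0)))

  open Endo Carrier using () renaming (_^_ to _^ᵉ_; ^-homo to ^ᵉ-homo)

  y^-+ : ∀ k a b → (y ^ᵉ k) (a + b) ≈ (y ^ᵉ k) a + (y ^ᵉ k) b
  y^-+ zero    a b = refl
  y^-+ (suc k) a b = trans (y-cong (y^-+ k a b)) (y-+ _ _)

  y^-homo : ∀ i j a → (y ^ᵉ (i ℕ.+ j)) a ≡ (y ^ᵉ i) ((y ^ᵉ j) a)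
  y^-homo i j a = ≡.cong (λ f → f a) (^ᵉ-homo y i j)

  -- Squaring 1 + φᵉ doubles its cross term, which vanishes.
  y^2^ : ∀ l a → (y ^ᵉ (2 ℕ.^ l)) a ≈ a + φ (2 ℕ.^ l) a
  y^2^ zero    a = refl
  y^2^ (suc l) a = begin
    (y ^ᵉ (e ℕ.+ (e ℕ.+ 0))) a                 ≡⟨ ≡.cong (λ d → (y ^ᵉ (e ℕ.+ d)) a) (ℕ.+-identityʳ e) ⟩
    (y ^ᵉ (e ℕ.+ e)) a                         ≡⟨ y^-homo e e a ⟩
    (y ^ᵉ e) ((y ^ᵉ e) a)                      ≈⟨ y^2^ l _ ⟩
    (y ^ᵉ e) a + φ e ((y ^ᵉ e) a)              ≈⟨ +-cong (y^2^ l a) (trans (φ-cong e (y^2^ l a)) (φ-+ e a _)) ⟩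
    (a + φ e a) + (φ e a + φ e (φ e a))        ≈⟨ solve 3 (λ a b c → (a :+ b) :+ (b :+ c) := a :+ c) refl a (φ e a) (φ e (φ e a)) ⟩
    a + φ e (φ e a)                            ≈⟨ +-congˡ (trans (φ-∘ e e a) (φ-≡ a (≡.cong (e ℕ.+_) (≡.sym (ℕ.+-identityʳ e))))) ⟩
    a + φ (e ℕ.+ (e ℕ.+ 0)) a                  ∎
    where e = 2 ℕ.^ l

  -- 1 + x + … + x^{2ˡ−1} = (1 + x)^{2ˡ−1} in characteristic 2
  sum-φ≈y^ : ∀ l m → suc m ≡ 2 ℕ.^ l → ∀ a → sumℕ (2 ℕ.^ l) (λ i → φ i a) ≈ (y ^ᵉ m) a
  sum-φ≈y^ zero    zero    _  a = trans (+-identityʳ _) (φ-0 a)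
  sum-φ≈y^ (suc l) m       e≡ a = begin
    sumℕ (e ℕ.+ (e ℕ.+ 0)) (λ i → φ i a)       ≡⟨ ≡.cong (λ d → sumℕ (e ℕ.+ d) (λ i → φ i a)) (ℕ.+-identityʳ e) ⟩
    sumℕ (e ℕ.+ e) (λ i → φ i a)               ≈⟨ sumℕ-split e e (λ i → φ i a) ⟩
    -- The upper half of the sum is φᵉ S, so the whole is (1 + φᵉ) S.
    S + sumℕ e (λ i → φ (e ℕ.+ i) a)           ≈⟨ +-congˡ (trans (sumℕ-cong e (λ i → sym (φ-∘ e i a))) (sym (φ-sum e e (λ i → φ i a)))) ⟩
    S + φ e S                                  ≈⟨ y^2^ l S ⟨
    (y ^ᵉ e) S                                 ≈⟨ y^-cong e (sum-φ≈y^ l p 1+p≡e a) ⟩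
    (y ^ᵉ e) ((y ^ᵉ p) a)                      ≡⟨ y^-homo e p a ⟨
    (y ^ᵉ (e ℕ.+ p)) a                         ≡⟨ ≡.cong (λ d → (y ^ᵉ d) a) e+p≡m ⟩
    (y ^ᵉ m) a                                 ∎
    where
    e = 2 ℕ.^ l
    p = ℕ.pred e
    S = sumℕ e (λ i → φ i a)
    1+p≡e : suc p ≡ e
    1+p≡e = ℕ.suc-pred e {{ℕ.m^n≢0 2 l}}
    e+p≡m : e ℕ.+ p ≡ m
    e+p≡m = ℕ.suc-injective (≡.trans (≡.sym (ℕ.+-suc e p)) (≡.trans (≡.cong (e ℕ.+_) (≡.trans 1+p≡e (≡.sym (ℕ.+-identityʳ e)))) (≡.sym e≡)))
    y^-cong : ∀ k {a b} → a ≈ b → (y ^ᵉ k) a ≈ (y ^ᵉ k) b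
    y^-cong zero    e = e
    y^-cong (suc k) e = y-cong (y^-cong k e)

  -- ker y = {0, 1}, and `bit` separates a from a + 1. So a is determined by
  -- y^k a together with k bits.
  bit : Carrier → Bool
  bit a = isYes (index a Fin.<? index (a + 1#))

  a+1+1≈a : ∀ a → a + 1# + 1# ≈ a
  a+1+1≈a a = solve 2 (λ a b → a :+ b :+ b := a) refl a 1#

  -- Adding 1 twice returns to a, so the two bits compare the same two distinct indices in opposite
  -- orders.
  bit-separates : ∀ a → bit a ≢ bit (a + 1#)
  bit-separates a eq with index a Fin.<? index (a + 1#) | index (a + 1#) Fin.<? index (a + 1# + 1#)
  ... | yes i<j | yes j<i = ℕ.<-asym i<j (≡.subst (λ i → index (a + 1#) Fin.< i) (index-cong (a+1+1≈a a)) j<i)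
  ... | no i≮j | no j≮i = 1≉0 (GroupProperties.∙-cancelˡ +-group a _ _ (trans (sym (index-injective
          (Fin.toℕ-injective (ℕ.≤-antisym (ℕ.≮⇒≥ (j≮i ∘ ≡.subst (λ i → index (a + 1#) Fin.< i) (≡.sym (index-cong (a+1+1≈a a))))) (ℕ.≮⇒≥ i≮j)))))
          (sym (+-identityʳ a))))

  bits-injective : ∀ k {a b} → (∀ (j : Fin k) → bit ((y ^ᵉ toℕ j) a) ≡ bit ((y ^ᵉ toℕ j) b)) → (y ^ᵉ k) a ≈ (y ^ᵉ k) b → a ≈ b
  bits-injective zero    bits e = e
  -- The images of a and b under yᵏ differ by an element of ker y = {0, 1}; the last bit excludes 1.
  bits-injective (suc k) {a} {b} bits e = bits-injective k bits′ (case ker-y (trans (y-+ u v) (trans (+-congʳ e) (+-self _))) of λ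
    { (inj₁ u+v≈0) → x+y≈0⇒x≈y u+v≈0
    ; (inj₂ u+v≈1) → contradiction (≡.trans (≡.sym bit-k) (bit-cong (v≈u+1 u+v≈1))) (bit-separates u)
    })
    where
    u v : Carrier
    u = (y ^ᵉ k) a
    v = (y ^ᵉ k) b
    bits′ : ∀ (j : Fin k) → bit ((y ^ᵉ toℕ j) a) ≡ bit ((y ^ᵉ toℕ j) b)
    bits′ j = ≡.subst (λ i → bit ((y ^ᵉ i) a) ≡ bit ((y ^ᵉ i) b)) (Fin.toℕ-inject₁ j) (bits (Fin.inject₁ j))
    bit-k : bit v ≡ bit u
    bit-k = ≡.sym (≡.subst (λ i → bit ((y ^ᵉ i) a) ≡ bit ((y ^ᵉ i) b)) (Fin.toℕ-fromℕ k) (bits (Fin.fromℕ k)))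
    bit-cong : ∀ {a b} → a ≈ b → bit a ≡ bit b
    bit-cong e = ≡.cong₂ (λ i j → isYes (i Fin.<? j)) (index-cong e) (index-cong (+-congʳ e))
    v≈u+1 : u + v ≈ 1# → v ≈ u + 1#
    v≈u+1 e = trans (solve 2 (λ u v → v := u :+ (u :+ v)) refl u v) (+-congˡ e)

-- Normal elements and trace 1

module Normal {c ℓ₁ ℓ₂} (F : HeytingField c ℓ₁ ℓ₂) (n : ℕ) (order : HasOrder F (2 ℕ.^ n))
  (m s : ℕ) (n≡1+m : n ≡ suc m) (n≡2^s : n ≡ 2 ℕ.^ s) where

  open Frobenius F n order public
  open import Relation.Binary.Reasoning.Setoid setoid
  open Char2Solver using (solve; _:+_; _:*_; _:=_)
  open Endo Carrier using () renaming (_^_ to _^ᵉ_)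

  private instance
    n-nonZero : NonZero n
    n-nonZero = ≡.subst NonZero (≡.sym n≡1+m) _

  Tr≈y^m : ∀ a → Tr n a ≈ (y ^ᵉ m) a
  Tr≈y^m a = trans (reflexive (≡.cong (λ n → sumℕ n (λ i → φ i a)) n≡2^s))
    (sum-φ≈y^ s m (≡.trans (≡.sym n≡1+m) n≡2^s) a)

  y^n≈0 : ∀ a → (y ^ᵉ n) a ≈ 0#
  y^n≈0 a = begin
    (y ^ᵉ n) a             ≡⟨ ≡.cong (λ n → (y ^ᵉ n) a) n≡2^s ⟩
    (y ^ᵉ (2 ℕ.^ s)) a     ≈⟨ y^2^ s a ⟩
    a + φ (2 ℕ.^ s) a      ≈⟨ +-congˡ (trans (φ-≡ a (≡.sym n≡2^s)) (φ-n a)) ⟩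
    a + a                  ≈⟨ +-self a ⟩
    0#                     ∎

  -- If Tr = yᵐ vanished everywhere, m bits would determine an element, giving an injection of 2ⁿ
  -- elements into 2ⁿ⁻¹ codes.
  exists-Tr≈1 : ∃ λ a → Tr n a ≈ 1#
  exists-Tr≈1 with ∃? (λ a≈b Tra≈1 → trans (Tr-cong (sym a≈b)) Tra≈1) (λ a → Tr n a ≟ 1#)
  ... | yes a = a
  ... | no ∄a = contradiction
    (ℕ.^-monoʳ-< 2 (ℕ.s≤s (ℕ.s≤s ℕ.z≤n)) m<n)
    (ℕ.≤⇒≯ (Fin.injective⇒≤ code-injective))
    where
    m<n : m ℕ.< n
    m<n = ℕ.≤-reflexive (≡.sym n≡1+m)
    y^m≈0 : ∀ a → (y ^ᵉ m) a ≈ 0#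
    y^m≈0 a = trans (sym (Tr≈y^m a)) (case idempotent⇒0∨1 (Tr-idempotent a) of λ
      { (inj₁ e) → e ; (inj₂ e) → contradiction (a , e) ∄a })
    code : Fin q → Fin (2 ℕ.^ m)
    code i = encode {m} (λ j → bit ((y ^ᵉ toℕ j) (element i)))
    code-injective : ∀ {i j} → code i ≡ code j → i ≡ j
    code-injective {i} {j} e = element-injective (bits-injective m (encode-injective e)
      (trans (y^m≈0 _) (sym (y^m≈0 _))))

  -- Tr α is the sum of all conjugates, so trace 0 would be a nontrivial linear relation.
  normal⇒Tr≈1 : ∀ {α} → IsNormal n α → Tr n α ≈ 1#
  normal⇒Tr≈1 {α} (independent , _) = case idempotent⇒0∨1 (Tr-idempotent α) of λ
    { (inj₁ Tr≈0) → contradiction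
        (independent (λ _ → true) (trans (sum-cong-≋ {n} (λ i → *-identityˡ (φ (toℕ i) α))) Tr≈0) (0 mod n)) λ ()
    ; (inj₂ Tr≈1) → Tr≈1
    }

  module _ (α : Carrier) where

    -- Conjugates are indexed by all of ℕ, so closure under φ needs no wrap-around; reduction modulo
    -- n is left to `span⇒combination`.
    data Span : Carrier → Set (c ⊔ ℓ₁) where
      zero      : Span 0#
      conjugate : ∀ i → Span (φ i α)
      plus      : ∀ {a b} → Span a → Span b → Span (a + b)
      resp      : ∀ {a b} → a ≈ b → Span a → Span b

    span-φ : ∀ {a} → Span a → Span (φ 1 a)
    span-φ zero             = resp (sym (φ-0# 1)) zero
    span-φ (conjugate i)    = resp (sym (φ-∘ 1 i α)) (conjugate (suc i))
    span-φ (plus sa sb)     = resp (sym (φ-+ 1 _ _)) (plus (span-φ sa) (span-φ sb))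
    span-φ (resp a≈b sa)    = resp (φ-cong 1 a≈b) (span-φ sa)

    span-y^ : ∀ k {a} → Span a → Span ((y ^ᵉ k) a)
    span-y^ zero    sa = sa
    span-y^ (suc k) sa = plus (span-y^ k sa) (span-φ (span-y^ k sa))

    -- As ker y = {0, 1} and 1 = Tr α = yᵐ α, the span of α contains ker yᵏ for all k ≤ n.
    kernel⊆span : Tr n α ≈ 1# → ∀ k d → k ℕ.+ d ≡ n → ∀ a → (y ^ᵉ k) a ≈ 0# → Span a
    kernel⊆span Tr≈1 zero    d k+d≡n a e = resp (sym e) zero
    kernel⊆span Tr≈1 (suc k) d k+d≡n a e = case ker-y e of λ
      { (inj₁ e₀) → kernel⊆span Tr≈1 k (suc d) (≡.trans (ℕ.+-suc k d) k+d≡n) a e₀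
      ; (inj₂ e₁) → resp (trans (+-assoc a β β) (trans (+-congˡ (+-self β)) (+-identityʳ a)))
          (plus (kernel⊆span Tr≈1 k (suc d) (≡.trans (ℕ.+-suc k d) k+d≡n) (a + β) (begin
            (y ^ᵉ k) (a + β)              ≈⟨ y^-+ k a β ⟩
            (y ^ᵉ k) a + (y ^ᵉ k) β       ≈⟨ +-cong e₁ y^kβ≈1 ⟩
            1# + 1#                       ≈⟨ 1+1≈0 ⟩
            0#                            ∎)) (span-y^ d (resp (φ-0 α) (conjugate 0))))
      }
      where
      β : Carrier
      -- As k + d = m, yᵏ β = yᵐ α = Tr α = 1; adding β therefore moves a from yᵏ a = 1 into ker yᵏ.
      β = (y ^ᵉ d) α
      y^kβ≈1 : (y ^ᵉ k) β ≈ 1#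
      y^kβ≈1 = begin
        (y ^ᵉ k) ((y ^ᵉ d) α)    ≡⟨ y^-homo k d α ⟨
        (y ^ᵉ (k ℕ.+ d)) α       ≡⟨ ≡.cong (λ e → (y ^ᵉ e) α) (ℕ.suc-injective (≡.trans k+d≡n n≡1+m)) ⟩
        (y ^ᵉ m) α               ≈⟨ Tr≈y^m α ⟨
        Tr n α                   ≈⟨ Tr≈1 ⟩
        1#                       ∎

    combination-+ : ∀ k k′ → combination (λ i → k i xor k′ i) (conjugates n α) ≈ combination k (conjugates n α) + combination k′ (conjugates n α)
    combination-+ k k′ = trans
      (sum-cong-≋ {n} (λ i → trans (*-congʳ (ι-+ (k i) (k′ i))) (distribʳ (φ (toℕ i) α) (ι (k i)) (ι (k′ i)))))
      (∑-distrib-+ {n} (λ i → ι (k i) * φ (toℕ i) α) (λ i → ι (k′ i) * φ (toℕ i) α))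

    combination-cong : ∀ {k k′ : Vector Bool n} → k ≗ k′ → combination k (conjugates n α) ≈ combination k′ (conjugates n α)
    combination-cong eq = sum-cong-≋ {n} (λ i → *-congʳ (reflexive (≡.cong ι (eq i))))

    combination-0 : combination (λ _ → false) (conjugates n α) ≈ 0#
    combination-0 = trans (sum-cong-≋ {n} (λ i → zeroˡ (φ (toℕ i) α))) (sum-replicate-zero n)

    φ-% : ∀ i → φ i α ≈ φ (i % n) α
    φ-% i = begin
      φ i α                                ≈⟨ φ-≡ α (m≡m%n+[m/n]*n i n) ⟩
      φ (i % n ℕ.+ i / n ℕ.* n) α          ≈⟨ φ-∘ (i % n) (i / n ℕ.* n) α ⟨
      φ (i % n) (φ (i / n ℕ.* n) α)        ≈⟨ φ-cong (i % n) (φ-kn (i / n) α) ⟩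
      φ (i % n) α                          ∎

    span⇒combination : ∀ {a} → Span a → ∃ λ k → a ≈ combination k (conjugates n α)
    span⇒combination zero = (λ _ → false) , sym combination-0
    span⇒combination (conjugate i) = unit , sym (begin
      combination unit (conjugates n α)      ≈⟨ sum-single +-commutativeMonoid (i mod n) (λ j → ι (unit j) * φ (toℕ j) α) off ⟩
      ι (unit (i mod n)) * φ (toℕ (i mod n)) α ≈⟨ *-cong on (trans (φ-≡ {j = i % n} α (Fin.toℕ-fromℕ< (ℕ.m%n<n i n))) (sym (φ-% i))) ⟩
      1# * φ i α                             ≈⟨ *-identityˡ _ ⟩
      φ i α                                  ∎)
      where
      unit : Vector Bool n
      unit j = isYes (j Fin.≟ i mod n)
      off : ∀ j → j ≢ i mod n → ι (unit j) * φ (toℕ j) α ≈ 0#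
      off j j≢ with j Fin.≟ i mod n
      ... | yes j≡ = contradiction j≡ j≢
      ... | no  _  = zeroˡ _
      on : ι (unit (i mod n)) ≈ 1#
      on with i mod n Fin.≟ i mod n
      ... | yes _  = refl
      ... | no  ¬e = contradiction ≡.refl ¬e
    span⇒combination (plus sa sb) with span⇒combination sa | span⇒combination sb
    ... | k , ea | k′ , eb = _ , trans (+-cong ea eb) (sym (combination-+ k k′))
    span⇒combination (resp a≈b sa) with span⇒combination sa
    ... | k , ea = k , trans (sym a≈b) ea

    -- A choice of coefficients is an injection of F into 𝔽₂ⁿ, hence surjective.
    spanning⇒independent : Spanning (conjugates n α) → LinearlyIndependent (conjugates n α)
    -- By surjectivity both k and the zero vector are chosen coefficients; their combinations agree,
    -- so they belong to the same element.
    spanning⇒independent spans k k≈0 i = ≡.trans (≡.sym (coefficients-of k i))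
      (≡.trans (≡.cong (λ j → coefficients j i) (element-injective (trans (value k) (trans k≈0 (sym (trans (value (λ _ → false)) combination-0))))))
        (coefficients-of (λ _ → false) i))
      where
      coefficients : Fin q → Vector Bool n
      coefficients j = proj₁ (spans (element j))
      code-injective : ∀ {i j} → encode (coefficients i) ≡ encode (coefficients j) → i ≡ j
      code-injective {i} {j} e = element-injective (trans (proj₂ (spans (element i)))
        (trans (combination-cong (encode-injective e)) (sym (proj₂ (spans (element j))))))
      preimage : ∀ k → ∃ λ j → encode (coefficients j) ≡ encode k
      preimage k = injective⇒surjective (encode ∘ coefficients) code-injective (encode k)
      coefficients-of : ∀ k → coefficients (proj₁ (preimage k)) ≗ k
      coefficients-of k = encode-injective (proj₂ (preimage k))
      value : ∀ k → element (proj₁ (preimage k)) ≈ combination k (conjugates n α)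
      value k = trans (proj₂ (spans (element (proj₁ (preimage k))))) (combination-cong (coefficients-of k))

    Tr≈1⇒normal : Tr n α ≈ 1# → IsNormal n α
    Tr≈1⇒normal Tr≈1 = spanning⇒independent spans , spans
      where
      spans : Spanning (conjugates n α)
      spans a = span⇒combination (kernel⊆span Tr≈1 n 0 (ℕ.+-identityʳ n) a (y^n≈0 a))

-- The trace form and autocorrelations

module Corresponding {c ℓ₁ ℓ₂} (F : HeytingField c ℓ₁ ℓ₂) (n m h N l : ℕ) (order : HasOrder F (2 ℕ.^ n))
  (n≡1+m : n ≡ suc m) (n≡h+h : n ≡ h ℕ.+ h) (h≡2N : h ≡ N ℕ.* 2) (h≡2^l : h ≡ 2 ℕ.^ l) where

  n≡2^1+l : n ≡ 2 ℕ.^ suc l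
  n≡2^1+l = ≡.trans n≡h+h (≡.cong₂ ℕ._+_ h≡2^l (≡.trans h≡2^l (≡.sym (ℕ.+-identityʳ (2 ℕ.^ l)))))

  open Normal F n order m (suc l) n≡1+m n≡2^1+l public
  open EvenSequences n m h N l n≡1+m n≡h+h h≡2N h≡2^l public
  open Endo Carrier using () renaming (_^_ to _^ᵉ_)
  open Endo Sequence using () renaming (_^_ to _^∘_)

  -- The corresponding vector is the diagonal of this biadditive form; expanding it at c α requires
  -- the mixed values.
  correlation : Carrier → Carrier → Sequence
  correlation α β i = tr (α * φ i β)

  autocorrelation : Carrier → Sequence
  autocorrelation α = correlation α α

  module _ where
    open import Relation.Binary.Reasoning.Setoid setoid
    open Char2Solver using (solve; _:+_; _:*_; _:=_)

    -- φʲ preserves Tr and takes α · φⁱ α to φʲ α · α when n divides i + j.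
    autocorrelation-even : ∀ α → Even (autocorrelation α)
    autocorrelation-even α i j k i+j≡kn = tr-≡ (begin
      Tr n (α * φ i α)            ≈⟨ Tr-φ j _ ⟨
      Tr n (φ j (α * φ i α))      ≈⟨ Tr-cong (trans (φ-* j α _) (*-congˡ (φ-∘ j i α))) ⟩
      Tr n (φ j α * φ (j ℕ.+ i) α) ≈⟨ Tr-cong (*-congˡ (trans (φ-≡ α (≡.trans (ℕ.+-comm j i) i+j≡kn)) (φ-kn k α))) ⟩
      Tr n (φ j α * α)            ≈⟨ Tr-cong (*-comm _ _) ⟩
      Tr n (α * φ j α)            ∎)

    autocorrelation-at-0 : ∀ α → autocorrelation α 0 ≡ tr α
    autocorrelation-at-0 α = ≡.trans (tr-cong (trans (*-congˡ (φ-0 α)) (sym (φ-1 α)))) (tr-φ 1 α)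

    -- α · φʰ α is fixed by φʰ, so its trace is twice its trace from the fixed field of φʰ.
    autocorrelation-at-h : ∀ α → autocorrelation α h ≡ false
    autocorrelation-at-h α = ι-injective (begin
      ι (tr γ)                                       ≈⟨ ι-tr γ ⟩
      sumℕ n (λ i → φ i γ)                           ≡⟨ ≡.cong (λ n → sumℕ n (λ i → φ i γ)) n≡h+h ⟩
      sumℕ (h ℕ.+ h) (λ i → φ i γ)                   ≈⟨ sumℕ-split h h (λ i → φ i γ) ⟩
      S + sumℕ h (λ i → φ (h ℕ.+ i) γ)               ≈⟨ +-congˡ (sumℕ-cong h (λ i → trans (φ-≡ γ (ℕ.+-comm h i)) (trans (sym (φ-∘ i h γ)) (φ-cong i φhγ≈γ)))) ⟩
      S + S                                          ≈⟨ +-self S ⟩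
      0#                                             ∎)
      where
      γ S : Carrier
      γ = α * φ h α
      S = sumℕ h (λ i → φ i γ)
      φhγ≈γ : φ h γ ≈ γ
      φhγ≈γ = begin
        φ h (α * φ h α)              ≈⟨ φ-* h α _ ⟩
        φ h α * φ h (φ h α)          ≈⟨ *-congˡ (trans (φ-∘ h h α) (trans (φ-≡ α (≡.sym n≡h+h)) (φ-n α))) ⟩
        φ h α * α                    ≈⟨ *-comm _ _ ⟩
        α * φ h α                    ∎

    autocorrelation-even₀ : ∀ α → Even₀ (autocorrelation α)
    autocorrelation-even₀ α = autocorrelation-even α , autocorrelation-at-h α

    h*2≡n : h ℕ.* 2 ≡ n
    h*2≡n = ≡.trans (ℕ.*-comm h 2) (≡.trans (≡.cong (h ℕ.+_) (ℕ.+-identityʳ h)) (≡.sym n≡h+h))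

    T : Carrier → Carrier
    T = trace 2 h

    T-+-φ : ∀ x → T x + T (φ 1 x) ≈ Tr n x
    T-+-φ x = begin
      T x + T (φ 1 x)                                                 ≈⟨ +-congˡ (sumℕ-cong h (λ j → trans (φ-∘ (j ℕ.* 2) 1 x) (φ-≡ x (ℕ.+-comm (j ℕ.* 2) 1)))) ⟩
      T x + sumℕ h (λ j → φ (suc (j ℕ.* 2)) x)                        ≈⟨ sumℕ-+ h (λ j → φ (j ℕ.* 2) x) (λ j → φ (suc (j ℕ.* 2)) x) ⟨
      sumℕ h (λ j → φ (j ℕ.* 2) x + φ (suc (j ℕ.* 2)) x)              ≈⟨ sumℕ-pairs h (λ j → φ j x) ⟨
      sumℕ (h ℕ.* 2) (λ j → φ j x)                                    ≡⟨ ≡.cong (λ n → sumℕ n (λ j → φ j x)) h*2≡n ⟩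
      Tr n x                                                          ∎

    -- θ = T α is the trace of α to 𝔽₄ and satisfies θ + θ² = 1, hence θ · θ² = 1.
    -- Expanding θ · θ² and pairing the odd exponents d and n − d gives the sum.
    ∑odd-autocorrelation : ∀ α → Tr n α ≈ 1# → ∑odd N (autocorrelation α) ≡ true
    ∑odd-autocorrelation α Tr≈1 = ι-injective (begin
      ι (∑odd N (autocorrelation α))                      ≈⟨ ι-sum N (λ k → autocorrelation α (suc (k ℕ.* 2))) ⟩
      sumℕ N (λ k → ι (tr (P k)))                         ≈⟨ sumℕ-cong N (λ k → trans (ι-tr (P k)) (sym (T-+-φ (P k)))) ⟩
      sumℕ N (λ k → T (P k) + T (φ 1 (P k)))              ≈⟨ sumℕ-+ N (T ∘ P) (T ∘ φ 1 ∘ P) ⟩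
      -- Exponents 2i + 1 and 2 (N + j) + 1 with i + j = N - 1 add up to 4N = n, so the second half
      -- supplies the terms from N to h - 1.
      sumℕ N (T ∘ P) + sumℕ N (T ∘ φ 1 ∘ P)               ≈⟨ +-congˡ (sumℕ-reverse N (T ∘ φ 1 ∘ P) (λ k → T (P (N ℕ.+ k))) reflect) ⟩
      sumℕ N (T ∘ P) + sumℕ N (λ k → T (P (N ℕ.+ k)))     ≈⟨ sumℕ-split N N (T ∘ P) ⟨
      sumℕ (N ℕ.+ N) (T ∘ P)                              ≡⟨ ≡.cong (λ h → sumℕ h (T ∘ P)) N+N≡h ⟩
      sumℕ h (T ∘ P)                                      ≈⟨ trace-sum 2 h h P ⟨
      T (sumℕ h P)                                        ≈⟨ trace-cong 2 h (*-distribˡ-sum {h} α (λ k → φ (suc (toℕ k ℕ.* 2)) α)) ⟨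
      -- θ² is fixed by every even power of φ and so comes out of T as a factor.
      T (α * θ²)                                          ≈⟨ sumℕ-cong h (λ j → trans (φ-* (j ℕ.* 2) α θ²) (*-congˡ (φ-θ² j))) ⟩
      sumℕ h (λ j → φ (j ℕ.* 2) α * θ²)                   ≈⟨ *-distribʳ-sum {h} θ² (λ j → φ (toℕ j ℕ.* 2) α) ⟨
      θ * θ²                                              ≈⟨ θθ²≈1 ⟩
      1#                                                  ∎)
      where
      P : ℕ → Carrier
      P k = α * φ (suc (k ℕ.* 2)) α
      θ θ² : Carrier
      θ = T α
      θ² = sumℕ h (λ k → φ (suc (k ℕ.* 2)) α)
      N+N≡h : N ℕ.+ N ≡ h
      N+N≡h = ≡.trans (lemma N) (≡.sym h≡2N)
        where
        lemma : ∀ N → N ℕ.+ N ≡ N ℕ.* 2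
        lemma = solve-∀
      θ²≈Tφα : θ² ≈ T (φ 1 α)
      θ²≈Tφα = sumℕ-cong h (λ k → trans (φ-≡ α (ℕ.+-comm 1 (k ℕ.* 2))) (sym (φ-∘ (k ℕ.* 2) 1 α)))
      φ-θ² : ∀ j → φ (j ℕ.* 2) θ² ≈ θ²
      φ-θ² j = begin
        φ (j ℕ.* 2) θ²              ≈⟨ φ-cong (j ℕ.* 2) θ²≈Tφα ⟩
        φ (j ℕ.* 2) (T (φ 1 α))     ≈⟨ φ-trace (j ℕ.* 2) 2 h (φ 1 α) ⟩
        T (φ (j ℕ.* 2) (φ 1 α))     ≈⟨ trace-φ* 2 h h*2≡n j (φ 1 α) ⟩
        T (φ 1 α)                   ≈⟨ θ²≈Tφα ⟨
        θ²                          ∎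
      θ+θ²≈1 : θ + θ² ≈ 1#
      θ+θ²≈1 = trans (+-congˡ θ²≈Tφα) (trans (T-+-φ α) Tr≈1)
      θθ²≈1 : θ * θ² ≈ 1#
      θθ²≈1 = begin
        θ * θ²                      ≈⟨ solve 2 (λ a b → a :* b := a :* a :+ a :* (a :+ b)) refl θ θ² ⟩
        θ * θ + θ * (θ + θ²)        ≈⟨ +-cong (sym (φ-1 θ)) (trans (*-congˡ θ+θ²≈1) (*-identityʳ θ)) ⟩
        φ 1 θ + θ                   ≈⟨ +-congʳ (trans (φ-trace 1 2 h α) (sym θ²≈Tφα)) ⟩
        θ² + θ                      ≈⟨ +-comm _ _ ⟩
        θ + θ²                      ≈⟨ θ+θ²≈1 ⟩
        1#                          ∎
      reflect : ∀ i j → suc (i ℕ.+ j) ≡ N → T (φ 1 (P i)) ≈ T (P (N ℕ.+ j))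
      reflect i j 1+i+j≡N = begin
        -- T absorbs only even powers of φ; e is odd, and the extra φ makes the exponent even.
        T (φ 1 (P i))                            ≈⟨ trace-cong 2 h (φ-cong 1 φP≈P) ⟨
        T (φ 1 (φ e (P (N ℕ.+ j))))              ≈⟨ trace-cong 2 h (φ-∘ 1 e _) ⟩
        T (φ (suc i ℕ.* 2) (P (N ℕ.+ j)))        ≈⟨ trace-φ* 2 h h*2≡n (suc i) _ ⟩
        T (P (N ℕ.+ j))                          ∎
        where
        e d : ℕ
        e = suc (i ℕ.* 2)
        d = suc ((N ℕ.+ j) ℕ.* 2)
        e+d≡n : e ℕ.+ d ≡ n
        e+d≡n = ≡.trans (lemma i j N) (≡.trans (≡.cong (λ t → (t ℕ.+ N) ℕ.* 2) 1+i+j≡N) (≡.trans (≡.cong (ℕ._* 2) N+N≡h) h*2≡n))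
          where
          lemma : ∀ i j N → suc (i ℕ.* 2) ℕ.+ suc ((N ℕ.+ j) ℕ.* 2) ≡ (suc (i ℕ.+ j) ℕ.+ N) ℕ.* 2
          lemma = solve-∀
        φP≈P : φ e (P (N ℕ.+ j)) ≈ P i
        φP≈P = begin
          φ e (α * φ d α)           ≈⟨ φ-* e α _ ⟩
          φ e α * φ e (φ d α)       ≈⟨ *-congˡ (trans (φ-∘ e d α) (trans (φ-≡ α e+d≡n) (φ-n α))) ⟩
          φ e α * α                 ≈⟨ *-comm _ _ ⟩
          α * φ e α                 ∎

    -- The adjoint of φᵖ for the trace form is its inverse φ^p′; this realises the involution c* of
    -- the group algebra.
    correlation-φˡ : ∀ p p′ → p′ ℕ.+ p ≡ n → ∀ α β i → correlation (φ p α) β i ≡ correlation α β (p′ ℕ.+ i)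
    correlation-φˡ p p′ p′+p≡n α β i = tr-≡ (begin
      Tr n (φ p α * φ i β)              ≈⟨ Tr-φ p′ _ ⟨
      Tr n (φ p′ (φ p α * φ i β))       ≈⟨ Tr-cong (trans (φ-* p′ _ _) (*-cong (trans (φ-∘ p′ p α) (trans (φ-≡ α p′+p≡n) (φ-n α))) (φ-∘ p′ i β))) ⟩
      Tr n (α * φ (p′ ℕ.+ i) β)         ∎)

  correlation-+ʳ : ∀ α β γ i → correlation α (β + γ) i ≡ correlation α β i xor correlation α γ i
  correlation-+ʳ α β γ i = ≡.trans (tr-cong (trans (*-congˡ (φ-+ i β γ)) (distribˡ α _ _))) (tr-+ _ _)

  correlation-+ˡ : ∀ α β γ i → correlation (α + β) γ i ≡ correlation α γ i xor correlation β γ i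
  correlation-+ˡ α β γ i = ≡.trans (tr-cong (distribʳ _ α β)) (tr-+ _ _)

  correlation-φʳ : ∀ p α β i → correlation α (φ p β) i ≡ correlation α β (p ℕ.+ i)
  correlation-φʳ p α β i = tr-cong (*-congˡ (trans (φ-∘ i p β) (φ-≡ β (ℕ.+-comm i p))))

  m+1≡n : m ℕ.+ 1 ≡ n
  m+1≡n = ≡.trans (ℕ.+-comm m 1) (≡.sym n≡1+m)

  correlation-yʳ : ∀ α β i → correlation α (y β) i ≡ correlation α β i xor correlation α β (1 ℕ.+ i)
  correlation-yʳ α β i = ≡.trans (correlation-+ʳ α β (φ 1 β) i) (≡.cong (correlation α β i xor_) (correlation-φʳ 1 α β i))

  correlation-yˡ : ∀ α β i → correlation (y α) β i ≡ correlation α β i xor correlation α β (m ℕ.+ i)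
  correlation-yˡ α β i = ≡.trans (correlation-+ˡ α (φ 1 α) β i) (≡.cong (correlation α β i xor_) (correlation-φˡ 1 m m+1≡n α β i))

  -- The action of x + x⁻¹ on F. It is self-adjoint for the trace form, so in either argument of
  -- `correlation` it becomes z.
  ζ : Carrier → Carrier
  ζ x = φ 1 x + φ m x

  correlation-ζʳ : ∀ k α β → correlation α ((ζ ^ᵉ k) β) ≗ (z ^∘ k) (correlation α β)
  correlation-ζʳ zero    α β i = ≡.refl
  correlation-ζʳ (suc k) α β i = ≡.trans
    (≡.trans (correlation-+ʳ α (φ 1 γ) (φ m γ) i) (≡.cong₂ _xor_ (correlation-φʳ 1 α γ i) (correlation-φʳ m α γ i)))
    (shifts-cong 1 m (correlation-ζʳ k α β) i)
    where γ = (ζ ^ᵉ k) β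

  correlation-ζˡ : ∀ k α β → correlation ((ζ ^ᵉ k) α) β ≗ (z ^∘ k) (correlation α β)
  correlation-ζˡ zero    α β i = ≡.refl
  correlation-ζˡ (suc k) α β i = ≡.trans
    (≡.trans (correlation-+ˡ (φ 1 γ) (φ m γ) β i) (≡.trans
      (≡.cong₂ _xor_ (correlation-φˡ 1 m m+1≡n γ β i) (correlation-φˡ m 1 (≡.sym n≡1+m) γ β i))
      (Bool.xor-comm (correlation γ β (m ℕ.+ i)) (correlation γ β (1 ℕ.+ i)))))
    (shifts-cong 1 m (correlation-ζˡ k α β) i)
    where γ = (ζ ^ᵉ k) α

  -- This is multiplication by the norm of 1 + (1 + x) zᵏ: the mixed terms give zᵏ⁺¹ and the product
  -- of the two perturbations gives z²ᵏ⁺¹.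
  autocorrelation-perturbed : ∀ k α → let a = autocorrelation α in
    autocorrelation (α + y ((ζ ^ᵉ k) α)) ≗ a ⊕ ((z ^∘ suc k) a ⊕ (z ^∘ suc k) ((z ^∘ k) a))
  autocorrelation-perturbed k α i = begin
    correlation (α + y γ) (α + y γ) i
      ≡⟨ ≡.trans (correlation-+ˡ α (y γ) (α + y γ) i) (≡.cong₂ _xor_ (correlation-+ʳ α α (y γ) i) (correlation-+ʳ (y γ) α (y γ) i)) ⟩
    (a i xor correlation α (y γ) i) xor (correlation (y γ) α i xor correlation (y γ) (y γ) i)
      ≡⟨ ≡.cong₂ (λ p r → (a i xor p) xor r)
           (≡.trans (correlation-yʳ α γ i) (≡.cong₂ _xor_ (correlation-ζʳ k α α i) (correlation-ζʳ k α α (1 ℕ.+ i))))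
           (≡.cong₂ _xor_ (≡.trans (correlation-yˡ γ α i) (≡.cong₂ _xor_ (correlation-ζˡ k α α i) (correlation-ζˡ k α α (m ℕ.+ i)))) norm) ⟩
    (a i xor (u i xor u (1 ℕ.+ i))) xor ((u i xor u (m ℕ.+ i)) xor z (autocorrelation γ) i)
      -- The two copies of u i cancel: (1 + x) + (1 + x⁻¹) = z.
      ≡⟨ solve 5 (λ a b c d e → (a :+ (b :+ c)) :+ ((b :+ d) :+ e) := a :+ ((c :+ d) :+ e)) ≡.refl
           (a i) (u i) (u (1 ℕ.+ i)) (u (m ℕ.+ i)) (z (autocorrelation γ) i) ⟩
    a i xor ((z ^∘ suc k) a i xor z (autocorrelation γ) i)
      ≡⟨ ≡.cong (λ t → a i xor ((z ^∘ suc k) a i xor t)) (shifts-cong 1 m γ-autocorrelation i) ⟩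
    a i xor ((z ^∘ suc k) a i xor (z ^∘ suc k) ((z ^∘ k) a) i)  ∎
    where
    open ≡.≡-Reasoning
    open xor-∧-Solver using (solve; _:+_; _:=_)
    γ : Carrier
    γ = (ζ ^ᵉ k) α
    a u : Sequence
    a = autocorrelation α
    u = (z ^∘ k) a
    γ-autocorrelation : autocorrelation γ ≗ (z ^∘ k) ((z ^∘ k) a)
    γ-autocorrelation i = ≡.trans (correlation-ζˡ k α γ i) (z^-cong k (correlation-ζʳ k α α) i)
    norm : correlation (y γ) (y γ) i ≡ z (autocorrelation γ) i
    -- (1 + x)(1 + x⁻¹) = 1 + x + x⁻¹ + x x⁻¹, where periodicity makes the last term 1.
    norm = ≡.trans (correlation-yˡ γ (y γ) i) (≡.trans
      (≡.cong₂ _xor_ (correlation-yʳ γ γ i) (≡.trans (correlation-yʳ γ γ (m ℕ.+ i)) (≡.cong (v (m ℕ.+ i) xor_) periodic)))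
      (solve 3 (λ a b c → (a :+ b) :+ (c :+ a) := b :+ c) ≡.refl (v i) (v (1 ℕ.+ i)) (v (m ℕ.+ i))))
      where
      v = autocorrelation γ
      periodic : v (1 ℕ.+ (m ℕ.+ i)) ≡ v i
      periodic = ≡.trans (≡.cong (λ n → v (n ℕ.+ i)) (≡.sym n≡1+m)) (even⇒periodic (autocorrelation-even γ) i)

open import Data.Nat.Base using (_≤_; _^_; _∸_; s≤s; z≤n)

-- Successive approximation of a prescribed sequence

module Realisation {c ℓ₁ ℓ₂} (F : HeytingField c ℓ₁ ℓ₂) (n m h N l : ℕ) (order : HasOrder F (2 ℕ.^ n))
  (n≡1+m : n ≡ suc m) (n≡h+h : n ≡ h ℕ.+ h) (h≡2N : h ≡ N ℕ.* 2) (h≡2^l : h ≡ 2 ℕ.^ l) where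

  open Corresponding F n m h N l order n≡1+m n≡h+h h≡2N h≡2^l public
  open Endo Carrier using () renaming (_^_ to _^ᵉ_)

  tr≡true : ∀ {α} → Tr n α ≈ 1# → tr α ≡ true
  tr≡true {α} Tr≈1 = ι-injective (trans (ι-tr α) Tr≈1)

  Tr≈1 : ∀ {α} → tr α ≡ true → Tr n α ≈ 1#
  Tr≈1 {α} eq = trans (sym (ι-tr α)) (reflexive (≡.cong ι eq))

  -- Any element of trace 1 starts the induction at order 2. Trace 1 persists because each
  -- perturbation lies in the image of y, on which the trace vanishes.
  approximation : ∀ {t} → Even₀ t → t 0 ≡ true → ∑odd N t ≡ true →
    ∀ k → ∃ λ α → tr α ≡ true × Order≥ (2 ℕ.+ k) (t ⊕ autocorrelation α)
  approximation {t} t₀ t0≡1 ∑≡1 zero = α , tr≡true Trα≈1 , order≥2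
    (⊕-even₀ t₀ (autocorrelation-even₀ α))
    (≡.cong₂ _xor_ t0≡1 (≡.trans (autocorrelation-at-0 α) (tr≡true Trα≈1)))
    (≡.trans (∑odd-⊕ N t (autocorrelation α)) (≡.cong₂ _xor_ ∑≡1 (∑odd-autocorrelation α Trα≈1)))
    where
    α : Carrier
    α = proj₁ exists-Tr≈1
    Trα≈1 : Tr n α ≈ 1#
    Trα≈1 = proj₂ exists-Tr≈1
  approximation {t} t₀ t0≡1 ∑≡1 (suc k) = improve (approximation t₀ t0≡1 ∑≡1 k)
    where
    improve : (∃ λ α → tr α ≡ true × Order≥ (2 ℕ.+ k) (t ⊕ autocorrelation α)) →
      ∃ λ α → tr α ≡ true × Order≥ (3 ℕ.+ k) (t ⊕ autocorrelation α)
    improve (α , tr≡1 , w , w₀ , t-a≗) = by-leading-term (w 0) ≡.refl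
      where
      a : Sequence
      a = autocorrelation α
      by-leading-term : ∀ b → w 0 ≡ b → ∃ λ α → tr α ≡ true × Order≥ (3 ℕ.+ k) (t ⊕ autocorrelation α)
      by-leading-term false w0≡0 = α , tr≡1 , order≥-suc (2 ℕ.+ k) w₀ w0≡0 t-a≗
      by-leading-term true  w0≡1 = α′ , tr′ , proj₁ step , proj₁ (proj₂ step) , λ i → ≡.trans
          (≡.trans (≡.cong (t i xor_) (autocorrelation-perturbed (suc k) α i)) (≡.sym (Bool.xor-assoc (t i) (a i) _)))
          (proj₂ (proj₂ step) i)
        where
        α′ : Carrier
        -- The exponent is one less than the current order 2 + k, so the norm starts with 1 + z²⁺ᵏ.
        α′ = α + y ((ζ ^ᵉ suc k) α)
        tr′ : tr α′ ≡ true
        tr′ = ≡.trans (tr-+ α _) (≡.cong₂ _xor_ tr≡1 (tr-y ((ζ ^ᵉ suc k) α)))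
        step = order≥-step k {t ⊕ a} {w} {a} w₀ t-a≗ w0≡1 (autocorrelation-even₀ α) (≡.trans (autocorrelation-at-0 α) tr≡1)

  realisation : 2 ≤ h → ∀ {t} → Even₀ t → t 0 ≡ true → ∑odd N t ≡ true →
    ∃ λ α → Tr n α ≈ 1# × autocorrelation α ≗ t
  realisation 2≤h {t} t₀ t0≡1 ∑≡1 = α , Tr≈1 (proj₁ (proj₂ found)) , λ i →
    ≡.sym (xor-false (order≥h (≡.subst (λ k → Order≥ k (t ⊕ autocorrelation α)) (ℕ.m+[n∸m]≡n 2≤h) (proj₂ (proj₂ found))) i))
    where
    -- Counting from order 2, h - 2 improvements reach order h, where the difference is 0.
    found = approximation t₀ t0≡1 ∑≡1 (h ∸ 2)
    α : Carrier
    α = proj₁ found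
    xor-false : ∀ {a b} → a xor b ≡ false → a ≡ b
    xor-false {false} {false} _ = ≡.refl
    xor-false {true}  {true}  _ = ≡.refl

-- From vectors to periodic sequences

mod-cong : ∀ n .{{_ : NonZero n}} {i j} → i % n ≡ j % n → i mod n ≡ j mod n
mod-cong n {i} {j} eq = Fin.fromℕ<-cong _ _ eq (ℕ.m%n<n i n) (ℕ.m%n<n j n)

toℕ-mod : ∀ n .{{_ : NonZero n}} (i : Fin n) → toℕ i mod n ≡ i
toℕ-mod n i = Fin.toℕ-injective (≡.trans (Fin.toℕ-fromℕ< (ℕ.m%n<n (toℕ i) n)) (ℕ.m<n⇒m%n≡m (Fin.toℕ<n i)))

module _ {n h} .{{_ : NonZero n}} (n≡h+h : n ≡ h ℕ.+ h) (a : Vector Bool n) where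

  n/2≡h : n / 2 ≡ h
  n/2≡h = ≡.trans (≡.cong (_/ 2) (≡.trans n≡h+h (lemma h))) (ℕ.m*n/n≡m h 2)
    where
    lemma : ∀ h → h ℕ.+ h ≡ h ℕ.* 2
    lemma = solve-∀

  -- The hypothesis covers residues strictly between 0 and h. Those above h follow by exchanging the
  -- two indices, while 0 and h are their own negatives.
  periodic-extension-even : (∀ i → 1 ≤ i → i ≤ n / 2 ∸ 1 → a (i mod n) ≡ a ((n ∸ i) mod n)) →
    ∀ i j k → i ℕ.+ j ≡ k ℕ.* n → a (i mod n) ≡ a (j mod n)
  periodic-extension-even sym i j k eq with complementary-residues n i j k eq
  ... | inj₁ (i≡0 , j≡0) = ≡.cong a (mod-cong n (≡.trans i≡0 (≡.sym j≡0)))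
  ... | inj₂ r+r′≡n = ≡.trans (≡.sym (reduce i)) (≡.trans (reflect (i % n) (j % n) r+r′≡n (ℕ.m%n<n i n) (ℕ.m%n<n j n)) (reduce j))
    where
    reduce : ∀ i → a ((i % n) mod n) ≡ a (i mod n)
    reduce i = ≡.cong a (mod-cong n (ℕ.m%n%n≡m%n i n))
    below : ∀ r r′ → r ℕ.+ r′ ≡ n → r ℕ.< h → r′ ℕ.< n → a (r mod n) ≡ a (r′ mod n)
    below r r′ e r<h r′<n = ≡.trans (sym r 1≤r (≡.subst (λ h → r ≤ h ∸ 1) (≡.sym n/2≡h) (ℕ.<⇒≤pred r<h)))
      (≡.cong (λ t → a (t mod n)) (≡.trans (≡.cong (_∸ r) (≡.sym e)) (ℕ.m+n∸m≡n r r′)))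
      where
      1≤r : 1 ≤ r
      1≤r = ℕ.+-cancelʳ-≤ r′ 1 r (≡.subst (r′ ℕ.<_) (≡.sym e) r′<n)
    reflect : ∀ r r′ → r ℕ.+ r′ ≡ n → r ℕ.< n → r′ ℕ.< n → a (r mod n) ≡ a (r′ mod n)
    reflect r r′ e r<n r′<n with ℕ.<-cmp r h
    ... | tri< r<h _ _ = below r r′ e r<h r′<n
    ... | tri≈ _ r≡h _ = ≡.cong (λ t → a (t mod n)) (≡.trans r≡h (≡.sym (ℕ.+-cancelˡ-≡ h r′ h (≡.trans (≡.cong (ℕ._+ r′) (≡.sym r≡h)) (≡.trans e n≡h+h)))))
    ... | tri> _ _ h<r = ≡.sym (below r′ r (≡.trans (ℕ.+-comm r′ r) e)
      (ℕ.+-cancelˡ-< h r′ h (≡.subst (h ℕ.+ r′ ℕ.<_) (≡.trans e n≡h+h) (ℕ.+-monoˡ-< r′ h<r))) r<n)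

  oddSum≡∑odd : ∀ {N} → h ≡ N ℕ.* 2 → 0 ℕ.< h → oddSum n a ≡ ∑odd N (λ i → a (i mod n))
  oddSum≡∑odd {zero}  ≡.refl ()
  oddSum≡∑odd {suc N} h≡2N _ = ≡.trans
    (≡.cong (λ K → F₂.sum-syntax K λ j → let i = suc (toℕ j) in if i % 2 ℕ.≡ᵇ 1 then a (i mod n) else F₂.0#)
      (≡.trans (≡.cong (_∸ 1) n/2≡h) (≡.cong (_∸ 1) h≡2N)))
    (∑-odd-terms N (λ i → a (i mod n)))

theorem3p5 : ∀ {c ℓ₁ ℓ₂} (s n : ℕ) .{{_ : NonZero n}} → n ≡ 2 ^ s → 4 ≤ n →
    (F : HeytingField c ℓ₁ ℓ₂) → HasOrder F (2 ^ n) →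
    let open Extension F in
    (a : Vector F₂.Carrier n) →
    (∃ λ α → IsNormal n α × IsCorrespondingVector α a)
    ⇔
    ( (a (0 mod n) ≡ F₂.1# × a ((n / 2) mod n) ≡ F₂.0#)
    × (∀ i → 1 ≤ i → i ≤ n / 2 ∸ 1 → a (i mod n) ≡ a ((n ∸ i) mod n))
    × oddSum n a ≡ F₂.1# )
theorem3p5 0 _ ≡.refl (s≤s ())
theorem3p5 1 _ ≡.refl (s≤s (s≤s ()))
theorem3p5 (suc (suc s)) n n≡2^s _ F order a = mk⇔ necessary sufficient
  where
  N h : ℕ
  -- The exponent has been lowered by 2 using n ≥ 4, so n = 4N and h = 2N; evenness of h lets the
  -- odd sum end at h.
  N = 2 ^ s
  h = 2 ^ suc s
  n≡h+h : n ≡ h ℕ.+ h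
  n≡h+h = ≡.trans n≡2^s (≡.cong (h ℕ.+_) (ℕ.+-identityʳ h))
  h≡2N : h ≡ N ℕ.* 2
  h≡2N = ℕ.*-comm 2 N
  2≤h : 2 ≤ h
  2≤h = ℕ.*-monoʳ-≤ 2 (ℕ.m^n>0 2 s)
  open Realisation F n (ℕ.pred n) h N (suc s) order (≡.sym (ℕ.suc-pred n)) n≡h+h h≡2N ≡.refl

  t : Sequence
  t i = a (i mod n)
  n/2 : n / 2 ≡ h
  n/2 = n/2≡h {h = h} n≡h+h a
  oddSum≡ : oddSum n a ≡ ∑odd N t
  oddSum≡ = oddSum≡∑odd {h = h} n≡h+h a {N} h≡2N (ℕ.≤-trans (s≤s z≤n) 2≤h)

  necessary : (∃ λ α → IsNormal n α × IsCorrespondingVector α a) → _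
  necessary (α , normal , corresponding) =
    (≡.trans (t≗ 0) (≡.trans (autocorrelation-at-0 α) (tr≡true Trα≈1)) ,
     ≡.trans (≡.cong t n/2) (≡.trans (t≗ h) (autocorrelation-at-h α))) ,
    (λ i 1≤i i≤ → ≡.trans (t≗ i) (≡.trans (autocorrelation-even α i (n ∸ i) 1
      (≡.trans (ℕ.m+[n∸m]≡n (i≤n i≤)) (≡.sym (ℕ.*-identityˡ n)))) (≡.sym (t≗ (n ∸ i))))) ,
    ≡.trans oddSum≡ (≡.trans (∑odd-cong N t≗) (∑odd-autocorrelation α Trα≈1))
    where
    Trα≈1 : Tr n α ≈ 1#
    Trα≈1 = normal⇒Tr≈1 normal
    t≗ : t ≗ autocorrelation α
    t≗ i = ≡.trans (ι-injective (trans (corresponding (i mod n)) (sym (ι-tr _))))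
      (≡.trans (≡.cong (autocorrelation α) (Fin.toℕ-fromℕ< (ℕ.m%n<n i n))) (≡.sym (even-% (autocorrelation-even α) i)))
    i≤n : ∀ {i} → i ≤ n / 2 ∸ 1 → i ≤ n
    i≤n i≤ = ℕ.≤-trans i≤ (ℕ.≤-trans (ℕ.m∸n≤m (n / 2) 1) (ℕ.m/n≤m n 2))

  sufficient : _ → ∃ λ α → IsNormal n α × IsCorrespondingVector α a
  sufficient ((t0≡1 , th≡0) , reflected , ∑≡1) = α , Tr≈1⇒normal α (proj₁ (proj₂ found)) , λ i →
    trans (reflexive (≡.cong ι (≡.trans (≡.cong a (≡.sym (toℕ-mod n i))) (≡.sym (proj₂ (proj₂ found) (toℕ i)))))) (ι-tr _)
    where
    found = realisation 2≤h {t}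
      (periodic-extension-even {h = h} n≡h+h a reflected , ≡.trans (≡.cong t (≡.sym n/2)) th≡0)
      t0≡1 (≡.trans (≡.sym oddSum≡) ∑≡1)
    α : Carrier
    α = proj₁ found
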